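{- Let $p$ be a prime, let $F_p(n)$ denote the number of binomial coefficients $\binom{m}{k}$ with $0\le k\le m<n$ that are not divisible by $p$, let $\varrho_p=\log_p\binom{p+1}{2}$, and let $\beta_p:=\inf_{n\ge1}F_p(n)/n^{\varrho_p}$. For integers $\xi,\eta$ put $$B_{\xi,\eta}:=\binom{\xi+1}{2}\left(1+\frac{(p-2\eta)(p-2\eta+1)}{2\xi p(p+1)}\right)\left(\frac{2\xi+1}{2}-\frac{\eta}{p}\right)^{ -\varrho_p}.$$ Then $$\beta_5=\left(\tfrac32\right)^{1-\varrho_5},\qquad \beta_7=\left(\tfrac32\right)^{1-\varrho_7},\qquad \beta_{11}=\tfrac{59}{44}\left(\tfrac{22}{31}\right)^{\varrho_{11}}.$$ More generally, for every odd prime $p$ with $3\le p\le 113$ we have $\beta_p=B_{\xi,\eta}$, where $(\xi,\eta)$ is given by: $(\xi,\eta)=(1,0)$ for $p\in\{3,5,7\}$; $(\xi,\eta)=(1,1)$ for $p\in\{11,13,17,19,23\}$; $(\xi,\eta)=(2,1)$ for $p=29$; $(\xi,\eta)=(2,2)$ for $p\in\{31,37,41,43,47,53\}$; $(\xi,\eta)=(2,3)$ for $p\in\{59,61,67,71,73,79\}$; $(\xi,\eta)=(2,4)$ for $p\in\{83,89,97,101,103,107\}$; $(\xi,\eta)=(2,5)$ for $p\in\{109,113\}$.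
   Context: It is known that $\inf_{n\ge1}F_p(n)/n^{\varrho_p}=\liminf_{n\to\infty}F_p(n)/n^{\varrho_p}$. The value $B_{\xi,\eta}$ equals $G(\hat s)$ at the point $\hat s=\frac{2\xi+1}{2p}-\frac{\eta}{p^2}$, where $G$ is the function with $F_p(n)n^{ -\varrho_p}=G(np^{ -\lfloor\log_p n\rfloor-1})$ (this interpretation is not needed for the claim). -}

module Defs where

open import Data.Nat as ℕ using (ℕ; zero; suc)
open import Data.Nat.Divisibility using (_∣?_)
open import Data.Nat.Combinatorics using (_C_)
open import Data.Integer as ℤ using (ℤ; +_)
open import Data.Rational as ℚ using (ℚ; _/_; _<_; 0ℚ; 1ℚ)
open import Data.List using (List; []; _∷_; length; filter; upTo; map)
open import Data.Nat.ListAction using (sum)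
open import Data.Product using (_×_; _,_; ∃-syntax)
open import Relation.Nullary using (¬?)

row : ℕ → ℕ → ℕ
row p m = length (filter (λ k → ¬? (p ∣? (m C k))) (upTo (suc m)))

F : ℕ → ℕ → ℕ
F p n = sum (map (row p) (upTo n))

ℕ→ℚ : ℕ → ℚ
ℕ→ℚ n = + n / 1

_^ℚ_ : ℚ → ℕ → ℚ
q ^ℚ zero  = 1ℚ
q ^ℚ suc n = q ℚ.* (q ^ℚ n)

T : ℕ → ℕ
T p = (p ℕ.+ 1) C 2

-- Real numbers of the form  a · x^(-ϱ_p)  with a, x positive rationals,
-- represented by the pair (a , x).  (ϱ_p = log_p T_p is irrational in
-- general, so these are real numbers; we never build them, we only
-- compare them.)  For positive a,x,c,y:
--   a x^(-ϱ) ≤ c y^(-ϱ)  ⇔  ϱ·ln(y/x) ≤ ln(c/a)  ⇔  log_p(y/x) ≤ log_T(c/a)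
-- and real comparisons are unfolded through rational cuts
-- (x ≤ y ⇔ ∀ rational w, w < x → w < y ;  x < y ⇔ ∃ rational w, x < w < y),
-- a rational w being written (k - m)/v with k m v : ℕ, v ≥ 1:
--   w < log_p(y/x)  ⇔  p^k x^v < y^v p^m
--   log_p(y/x) < w  ⇔  y^v p^m < p^k x^v
--   w < log_T(c/a)  ⇔  T^k a^v < c^v T^m

PowMon : Set
PowMon = ℚ × ℚ     -- (a , x)  stands for  a · x^(-ϱ_p)

Le : ℕ → PowMon → PowMon → Set
Le p (a , x) (c , y) =
  ∀ k m v → 1 ℕ.≤ v →
    (ℕ→ℚ p ^ℚ k) ℚ.* (x ^ℚ v) < (y ^ℚ v) ℚ.* (ℕ→ℚ p ^ℚ m) →
    (ℕ→ℚ (T p) ^ℚ k) ℚ.* (a ^ℚ v) < (c ^ℚ v) ℚ.* (ℕ→ℚ (T p) ^ℚ m)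

Lt : ℕ → PowMon → PowMon → Set
Lt p (a , x) (c , y) =
  ∃[ k ] ∃[ m ] ∃[ v ] (1 ℕ.≤ v
    × (y ^ℚ v) ℚ.* (ℕ→ℚ p ^ℚ m) < (ℕ→ℚ p ^ℚ k) ℚ.* (x ^ℚ v)
    × (ℕ→ℚ (T p) ^ℚ k) ℚ.* (a ^ℚ v) < (c ^ℚ v) ℚ.* (ℕ→ℚ (T p) ^ℚ m))

ratio : ℕ → ℕ → PowMon
ratio p n = (ℕ→ℚ (F p n) , ℕ→ℚ n)

const : ℚ → PowMon
const q = (q , 1ℚ)

-- "β_p = b", i.e. b = inf_{n ≥ 1} F_p(n) / n^ϱ_p :
--  b is a lower bound, and every rational q > b is exceeded by some ratio
-- from below (no real number strictly above b is a lower bound; the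
-- rationals are dense, so testing rational q suffices).
IsBeta : ℕ → PowMon → Set
IsBeta p b =
  (∀ n → 1 ℕ.≤ n → Le p b (ratio p n))
  × (∀ q → 0ℚ < q → Lt p b (const q) → ∃[ n ] (1 ℕ.≤ n × Lt p (ratio p n) (const q)))

-- B_{ξ,η} = (ξ+1 choose 2) (1 + (p-2η)(p-2η+1)/(2ξp(p+1))) ((2ξ+1)/2 - η/p)^(-ϱ_p)
-- (only meaningful for p ≥ 1, ξ ≥ 1; the degenerate cases are never used)

Bcoef : ℕ → ℕ → ℕ → ℚ
Bcoef zero    _        _ = 0ℚ
Bcoef (suc _) zero     _ = 0ℚ
Bcoef p@(suc _) ξ@(suc _) η =
  (+ ((ξ ℕ.+ 1) C 2) / 1)
    ℚ.* (1ℚ ℚ.+ (d ℤ.* (d ℤ.+ + 1)) / (2 ℕ.* ξ ℕ.* p ℕ.* (p ℕ.+ 1)))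
  where
  d : ℤ
  d = + p ℤ.- + (2 ℕ.* η)

Bbase : ℕ → ℕ → ℕ → ℚ
Bbase zero      _ _ = 0ℚ
Bbase p@(suc _) ξ η = (+ (2 ℕ.* ξ ℕ.+ 1) / 2) ℚ.- (+ η / p)

B : ℕ → ℕ → ℕ → PowMon
B p ξ η = (Bcoef p ξ η , Bbase p ξ η)

table : List (ℕ × ℕ × ℕ)
table =
  (3 , 1 , 0) ∷ (5 , 1 , 0) ∷ (7 , 1 , 0) ∷
  (11 , 1 , 1) ∷ (13 , 1 , 1) ∷ (17 , 1 , 1) ∷ (19 , 1 , 1) ∷ (23 , 1 , 1) ∷
  (29 , 2 , 1) ∷
  (31 , 2 , 2) ∷ (37 , 2 , 2) ∷ (41 , 2 , 2) ∷ (43 , 2 , 2) ∷ (47 , 2 , 2) ∷ (53 , 2 , 2) ∷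
  (59 , 2 , 3) ∷ (61 , 2 , 3) ∷ (67 , 2 , 3) ∷ (71 , 2 , 3) ∷ (73 , 2 , 3) ∷ (79 , 2 , 3) ∷
  (83 , 2 , 4) ∷ (89 , 2 , 4) ∷ (97 , 2 , 4) ∷ (101 , 2 , 4) ∷ (103 , 2 , 4) ∷ (107 , 2 , 4) ∷
  (109 , 2 , 5) ∷ (113 , 2 , 5) ∷ []

{-# OPTIONS --safe #-}
module Submission where

-- Lucas' theorem gives F(p n + r) = T F(n) + row(n) r (r + 1) / 2 for r ≤ p, where
-- T = p (p + 1) / 2 and row(p n + r) = row(n) (r + 1) for r < p.  Hence
-- ψ(n / p ^ k) = F(n) / T ^ k is well defined and ψ(n + t) = F(n) + row(n) ψ(t) for
-- t ∈ [0 , 1].  On [0 , 1] the function ψ lies above two lines through (1/2 , 1/4),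
-- which form a corner there.  Since y ↦ y ^ ϱ is convex, B y ^ ϱ ≤ ψ(y) on [n , n + 1]
-- follows from comparing B y ^ ϱ with this corner at n, n + 1/2 and n + 1.  For the
-- primes of the table, cells of length 1 and 1 / p suffice, and the comparisons
-- become inequalities between integers once ϱ is replaced by a rational bound.
-- Equality holds at y = ξ + 1/2 - η / p, the limit of the numbers with base p digits
-- ξ, h - η, h, h, …, where h = (p - 1) / 2.

open import Defs
open import Data.Nat hiding (_/_)
open import Data.Nat.Properties
open import Data.Nat.Combinatorics hiding (_P_) renaming (_C_ to _choose_)
open import Data.Nat.Coprimality using (1-coprimeTo) renaming (sym to coprime-sym)
open import Data.Nat.Divisibility
open import Data.Nat.DivMod using (m/n*n≡m; m≡m%n+[m/n]*n; m%n<n) renaming (_/_ to _div_)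
open import Data.Nat.ListAction using (sum)
open import Data.Nat.ListAction.Properties using (sum-++)
open import Data.Nat.Primality using (Prime; prime?; euclidsLemma; prime⇒nonZero; prime⇒nonTrivial)
open import Data.Nat.Tactic.RingSolver using (solve-∀)
import Data.Integer as ℤ
import Data.Integer.Properties as ℤ
import Data.Rational as ℚ
import Data.Rational.Properties as ℚ
open import Data.Rational using (mkℚ; _/_)
open import Data.Rational.Solver using (module +-*-Solver)
open import Data.List using (List; []; _∷_; _++_; _∷ʳ_; length; filter; upTo; map)
open import Data.List.Properties using (upTo-∷ʳ; length-++; filter-++; map-++)
open import Data.List.Membership.Propositional using (_∈_)
open import Data.List.Membership.Propositional.Properties using (∈-map⁻)
open import Data.List.Relation.Unary.All using (All; all?; lookup)
open import Data.List.Relation.Unary.Any using (here; there)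
open import Data.Product using (_×_; _,_; ∃-syntax; proj₁; proj₂)
open import Data.Sum using (_⊎_; inj₁; inj₂)
open import Function using (it)
open import Relation.Nullary using (¬_; Dec; yes; no; ¬?; contradiction)
open import Relation.Nullary.Decidable using (_×-dec_; _⊎-dec_; from-yes)
open import Relation.Binary.PropositionalEquality

-- The middle digit `h` replaces t by (h + t) / p and multiplies differences of ψ by (h + 1) / T. As
-- T = p (h + 1), this map fixes (1/2 , 1/4) and preserves slopes. Every line through that point is
-- therefore carried to itself by the digit `h`, so the corner reproduces itself in the induction;
-- the remaining digits impose finitely many inequalities. The bound to be proved is sharp, yet ϱ is
-- irrational. Written as (A / E) (y / x) ^ ϱ, where x = X / D is the point of equality, it does not
-- depend on the exponent at y = x. A rational lower bound for ϱ is safe for y ≤ x and an upper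
-- bound for y ≥ x, and neither loses anything at x itself. Near x the necessary room comes from the
-- corner: x is the midpoint of a cell of length 1 / p, and the power curve passes through the
-- vertex with a slope between those of the two lines.

-- Finite sums.

Σ< : (ℕ → ℕ) → ℕ → ℕ
Σ< f zero    = 0
Σ< f (suc n) = Σ< f n + f n

Σ<-cong : ∀ {f g : ℕ → ℕ} n → (∀ {i} → i < n → f i ≡ g i) → Σ< f n ≡ Σ< g n
Σ<-cong zero    eq = refl
Σ<-cong (suc n) eq = cong₂ _+_ (Σ<-cong n λ i<n → eq (m<n⇒m<1+n i<n)) (eq ≤-refl)

Σ<-+ : ∀ f m n → Σ< f (m + n) ≡ Σ< f m + Σ< (λ i → f (m + i)) n
Σ<-+ f m zero    = trans (cong (Σ< f) (+-identityʳ m)) (sym (+-identityʳ _))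
Σ<-+ f m (suc n) = begin
  Σ< f (m + suc n)                                  ≡⟨ cong (Σ< f) (+-suc m n) ⟩
  Σ< f (m + n) + f (m + n)                          ≡⟨ cong (_+ f (m + n)) (Σ<-+ f m n) ⟩
  Σ< f m + Σ< (λ i → f (m + i)) n + f (m + n)       ≡⟨ +-assoc (Σ< f m) _ _ ⟩
  Σ< f m + (Σ< (λ i → f (m + i)) n + f (m + n))     ∎
  where open ≡-Reasoning

Σ<-*ʳ : ∀ f c n → Σ< (λ i → f i * c) n ≡ Σ< f n * c
Σ<-*ʳ f c zero    = refl
Σ<-*ʳ f c (suc n) = trans (cong (_+ f n * c) (Σ<-*ʳ f c n)) (sym (*-distribʳ-+ c (Σ< f n) (f n)))

Σ<-*ˡ : ∀ f c n → Σ< (λ i → c * f i) n ≡ c * Σ< f n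
Σ<-*ˡ f c zero    = sym (*-zeroʳ c)
Σ<-*ˡ f c (suc n) = trans (cong (_+ c * f n) (Σ<-*ˡ f c n)) (sym (*-distribˡ-+ c (Σ< f n) (f n)))

Σ<-zero : ∀ {f : ℕ → ℕ} n → (∀ {i} → i < n → f i ≡ 0) → Σ< f n ≡ 0
Σ<-zero zero    eq = refl
Σ<-zero (suc n) eq = cong₂ _+_ (Σ<-zero n λ i<n → eq (m<n⇒m<1+n i<n)) (eq ≤-refl)

Σ<-one : ∀ {f : ℕ → ℕ} n → (∀ {i} → i < n → f i ≡ 1) → Σ< f n ≡ n
Σ<-one zero    eq = refl
Σ<-one (suc n) eq = trans (cong₂ _+_ (Σ<-one n λ i<n → eq (m<n⇒m<1+n i<n)) (eq ≤-refl)) (+-comm n 1)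

Σ<-blocks : ∀ f b n → Σ< f (b * n) ≡ Σ< (λ q → Σ< (λ i → f (b * q + i)) b) n
Σ<-blocks f b zero    = cong (Σ< f) (*-zeroʳ b)
Σ<-blocks f b (suc n) = begin
  Σ< f (b * suc n)                                   ≡⟨ cong (Σ< f) (trans (*-suc b n) (+-comm b (b * n))) ⟩
  Σ< f (b * n + b)                                   ≡⟨ Σ<-+ f (b * n) b ⟩
  Σ< f (b * n) + Σ< (λ i → f (b * n + i)) b          ≡⟨ cong (_+ Σ< (λ i → f (b * n + i)) b) (Σ<-blocks f b n) ⟩
  Σ< (λ q → Σ< (λ i → f (b * q + i)) b) n + Σ< (λ i → f (b * n + i)) b ∎
  where open ≡-Reasoning

-- Rows of Pascal's triangle as sums of indicators.

nonDiv : ℕ → ℕ → ℕ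
nonDiv p a with p ∣? a
... | yes _ = 0
... | no  _ = 1

nonDiv-∣ : ∀ {p a} → p ∣ a → nonDiv p a ≡ 0
nonDiv-∣ {p} {a} p∣a with p ∣? a
... | yes _ = refl
... | no ¬p = contradiction p∣a ¬p

nonDiv-∤ : ∀ {p a} → ¬ p ∣ a → nonDiv p a ≡ 1
nonDiv-∤ {p} {a} p∤a with p ∣? a
... | yes d = contradiction d p∤a
... | no _  = refl

length-filter-nonDiv : ∀ p m n →
  length (filter (λ k → ¬? (p ∣? (m choose k))) (upTo n)) ≡ Σ< (λ k → nonDiv p (m choose k)) n
length-filter-nonDiv p m zero    = refl
length-filter-nonDiv p m (suc n) = begin
  length (filter P? (upTo (suc n)))                             ≡⟨ cong (λ l → length (filter P? l)) (upTo-∷ʳ n) ⟨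
  length (filter P? (upTo n ∷ʳ n))                              ≡⟨ cong length (filter-++ P? (upTo n) (n ∷ [])) ⟩
  length (filter P? (upTo n) ++ filter P? (n ∷ []))             ≡⟨ length-++ (filter P? (upTo n)) ⟩
  length (filter P? (upTo n)) + length (filter P? (n ∷ []))     ≡⟨ cong₂ _+_ (length-filter-nonDiv p m n) last ⟩
  Σ< (λ k → nonDiv p (m choose k)) n + nonDiv p (m choose n)              ∎
  where
  open ≡-Reasoning
  P? = λ k → ¬? (p ∣? (m choose k))
  last : length (filter P? (n ∷ [])) ≡ nonDiv p (m choose n)
  last with p ∣? (m choose n)
  ... | yes _ = refl
  ... | no  _ = refl

-- Entries beyond the diagonal are 0, hence divisible by `p`. Padding a row with them allows it to
-- be cut into whole blocks of `p` columns.
row-Σ : ∀ p m n → m < n → row p m ≡ Σ< (λ k → nonDiv p (m choose k)) n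
row-Σ p m n m<n = begin
  row p m                          ≡⟨ length-filter-nonDiv p m (suc m) ⟩
  Σ< f (suc m)                     ≡⟨ +-identityʳ _ ⟨
  Σ< f (suc m) + 0                 ≡⟨ cong (Σ< f (suc m) +_) (Σ<-zero (n ∸ suc m) (λ {i} _ → vanish i)) ⟨
  Σ< f (suc m) + Σ< (λ i → f (suc m + i)) (n ∸ suc m) ≡⟨ Σ<-+ f (suc m) (n ∸ suc m) ⟨
  Σ< f (suc m + (n ∸ suc m))       ≡⟨ cong (Σ< f) (m+[n∸m]≡n m<n) ⟩
  Σ< f n                           ∎
  where
  open ≡-Reasoning
  f = λ k → nonDiv p (m choose k)
  vanish : ∀ i → f (suc m + i) ≡ 0
  vanish i = nonDiv-∣ (subst (p ∣_) (sym (k>n⇒nCk≡0 (s≤s (m≤m+n m i)))) (p ∣0))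

F-suc : ∀ p n → F p (suc n) ≡ F p n + row p n
F-suc p n = begin
  sum (map (row p) (upTo (suc n)))                       ≡⟨ cong (λ l → sum (map (row p) l)) (upTo-∷ʳ n) ⟨
  sum (map (row p) (upTo n ∷ʳ n))                        ≡⟨ cong sum (map-++ (row p) (upTo n) (n ∷ [])) ⟩
  sum (map (row p) (upTo n) ++ (row p n ∷ []))           ≡⟨ sum-++ (map (row p) (upTo n)) (row p n ∷ []) ⟩
  F p n + (row p n + 0)                                  ≡⟨ cong (F p n +_) (+-identityʳ (row p n)) ⟩
  F p n + row p n                                        ∎
  where open ≡-Reasoning

tri : ℕ → ℕ
tri zero    = 0
tri (suc r) = tri r + suc r

2*tri : ∀ r → 2 * tri r ≡ r * suc r
2*tri zero    = refl
2*tri (suc r) = begin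
  2 * (tri r + suc r)       ≡⟨ *-distribˡ-+ 2 (tri r) (suc r) ⟩
  2 * tri r + 2 * suc r     ≡⟨ cong (_+ 2 * suc r) (2*tri r) ⟩
  r * suc r + 2 * suc r     ≡⟨ identity r ⟩
  suc r * suc (suc r)       ∎
  where
  open ≡-Reasoning
  identity : ∀ r → r * suc r + 2 * suc r ≡ suc r * suc (suc r)
  identity = solve-∀

T≡tri : ∀ p → T p ≡ tri p
T≡tri p = trans (cong (_choose 2) (+-comm p 1)) (go p)
  where
  go : ∀ n → suc n choose 2 ≡ tri n
  go zero    = refl
  go (suc n) = begin
    suc (suc n) choose 2          ≡⟨ nCk+nC[k+1]≡[n+1]C[k+1] (suc n) 1 ⟨
    suc n choose 1 + suc n choose 2    ≡⟨ cong₂ _+_ (nC1≡n (suc n)) (go n) ⟩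
    suc n + tri n            ≡⟨ +-comm (suc n) (tri n) ⟩
    tri n + suc n            ∎
    where open ≡-Reasoning

-- Lucas' congruence and the recursions in the last digit.

nC0≡1 : ∀ n → n choose 0 ≡ 1
nC0≡1 n = trans (nCk≡nC[n∸k] {n = n} z≤n) (nCn≡1 n)

nCk*k![n∸k]!≡n! : ∀ {n k} → k ≤ n → (n choose k) * (k ! * (n ∸ k) !) ≡ n !
nCk*k![n∸k]!≡n! {n} {k} k≤n =
  trans (cong (_* (k ! * (n ∸ k) !)) (nCk≡n!/k![n-k]! k≤n))
        (m/n*n≡m (k![n∸k]!∣n! k≤n))
  where instance _ = k !* (n ∸ k) !≢0

module Lucas {p : ℕ} (pp : Prime p) where

  private instance
    p≢0 = prime⇒nonZero pp

  1<p : 1 < p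
  1<p = nonTrivial⇒n>1 p {{prime⇒nonTrivial pp}}

  ∤! : ∀ {j} → j < p → ¬ p ∣ j !
  ∤! {zero}  _   d = <⇒≱ 1<p (∣⇒≤ d)
  ∤! {suc j} j<p d with euclidsLemma (suc j) (j !) pp d
  ... | inj₁ d′ = <⇒≱ j<p (∣⇒≤ d′)
  ... | inj₂ d′ = ∤! (<-trans (n<1+n j) j<p) d′

  ∤C : ∀ {j i} → i ≤ j → j < p → ¬ p ∣ j choose i
  ∤C {j} {i} i≤j j<p d =
    ∤! j<p (subst (p ∣_) (nCk*k![n∸k]!≡n! i≤j) (∣m⇒∣m*n (i ! * (j ∸ i) !) d))

  p∣p! : p ∣ p !
  p∣p! = go p
    where
    go : ∀ n → {{NonZero n}} → n ∣ n !
    go (suc n) = m∣m*n (n !)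

  p∣pCi : ∀ {i} → 0 < i → i < p → p ∣ p choose i
  p∣pCi {i} 0<i i<p
    with euclidsLemma (p choose i) (i ! * (p ∸ i) !) pp (subst (p ∣_) (sym (nCk*k![n∸k]!≡n! (<⇒≤ i<p))) p∣p!)
  ... | inj₁ d = d
  ... | inj₂ d with euclidsLemma (i !) ((p ∸ i) !) pp d
  ...   | inj₁ d′ = contradiction d′ (∤! i<p)
  ...   | inj₂ d′ = contradiction d′ (∤! (∸-monoʳ-< 0<i (<⇒≤ i<p)))

  private
    q = pred p

    suc-q : suc q ≡ p
    suc-q = suc-pred p

    q<p : q < p
    q<p = ≤-reflexive suc-q

    infix 4 _≋_
    _≋_ : ℕ → ℕ → Set
    a ≋ b = ∃[ t ] a ≡ b + t * p

    ≋-reflexive : ∀ {a b} → a ≡ b → a ≋ b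
    ≋-reflexive {b = b} eq = 0 , trans eq (sym (+-identityʳ b))

    pascal : ∀ n k {a b c} → n choose k ≋ a → n choose suc k ≋ b → a + b ≋ c → suc n choose suc k ≋ c
    pascal n k {a} {b} {c} (s , e) (t , f) (u , g) = s + t + u , (begin
      suc n choose suc k                  ≡⟨ nCk+nC[k+1]≡[n+1]C[k+1] n k ⟨
      n choose k + n choose suc k              ≡⟨ cong₂ _+_ e f ⟩
      a + s * p + (b + t * p)        ≡⟨ regroup a b s t p ⟩
      a + b + (s + t) * p            ≡⟨ cong (_+ (s + t) * p) g ⟩
      c + u * p + (s + t) * p        ≡⟨ regroup′ c s t u p ⟩
      c + (s + t + u) * p            ∎)
      where
      open ≡-Reasoning
      regroup : ∀ a b s t p → a + s * p + (b + t * p) ≡ a + b + (s + t) * p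
      regroup = solve-∀
      regroup′ : ∀ c s t u p → c + u * p + (s + t) * p ≡ c + (s + t + u) * p
      regroup′ = solve-∀

    next-block : ∀ m → suc (p * m + q) ≡ p * suc m + 0
    next-block m = begin
      suc (p * m + q)    ≡⟨ +-suc (p * m) q ⟨
      p * m + suc q      ≡⟨ cong (p * m +_) suc-q ⟩
      p * m + p          ≡⟨ +-comm (p * m) p ⟩
      p + p * m          ≡⟨ *-suc p m ⟨
      p * suc m          ≡⟨ +-identityʳ _ ⟨
      p * suc m + 0      ∎
      where open ≡-Reasoning

    nCk≡0ˡ : ∀ {n k} x → n < k → x * (n choose k) ≡ 0
    nCk≡0ˡ x n<k = trans (cong (x *_) (k>n⇒nCk≡0 n<k)) (*-zeroʳ x)

  -- The quotients never become negative, so Lucas' congruence can be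
  -- carried as an equation in ℕ.
  lucas : ∀ m j k i → j < p → i < p →
          ∃[ t ] (p * m + j) choose (p * k + i) ≡ (m choose k) * (j choose i) + t * p
  lucas zero zero zero zero _ _ = ≋-reflexive (cong₂ _choose_ (cong (_+ 0) (*-zeroʳ p)) (cong (_+ 0) (*-zeroʳ p)))
  lucas zero zero k (suc i) _ _ = ≋-reflexive (trans
    (cong (_choose (p * k + suc i)) (cong (_+ 0) (*-zeroʳ p)))
    (trans (k>n⇒nCk≡0 (subst (0 <_) (sym (+-suc (p * k) i)) z<s)) (sym (nCk≡0ˡ {0} {suc i} (0 choose k) z<s))))
  lucas zero zero (suc k) zero _ _ = ≋-reflexive
    (cong₂ _choose_ (cong (_+ 0) (*-zeroʳ p)) (sym (next-block k)))
  lucas (suc m) zero zero zero _ _ = ≋-reflexive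
    (trans (cong ((p * suc m + 0) choose_) (cong (_+ 0) (*-zeroʳ p)))
      (trans (nC0≡1 (p * suc m + 0)) (cong (_* 1) (sym (nC0≡1 (suc m))))))
  lucas (suc m) zero k (suc i) _ i<p =
    subst₂ (λ a b → a choose b ≋ (suc m choose k) * (0 choose suc i)) (next-block m) (sym (+-suc (p * k) i))
      (pascal (p * m + q) (p * k + i) (lucas m q k i q<p (<-trans (n<1+n i) i<p))
              (subst (λ b → (p * m + q) choose b ≋ (m choose k) * (q choose suc i)) (+-suc (p * k) i)
                (lucas m q k (suc i) q<p i<p))
              multiple)
    where
    open ≡-Reasoning
    -- Pascal's rule produces the factor `p choose suc i`, a multiple of `p`; the right-hand side is
    -- 0 because of its second factor.
    multiple : (m choose k) * (q choose i) + (m choose k) * (q choose suc i) ≋ (suc m choose k) * (0 choose suc i)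
    multiple with p∣pCi {suc i} z<s i<p
    ... | divides t eq = (m choose k) * t , (begin
      (m choose k) * (q choose i) + (m choose k) * (q choose suc i)       ≡⟨ *-distribˡ-+ (m choose k) _ _ ⟨
      (m choose k) * (q choose i + q choose suc i)                   ≡⟨ cong ((m choose k) *_) (nCk+nC[k+1]≡[n+1]C[k+1] q i) ⟩
      (m choose k) * (suc q choose suc i)                       ≡⟨ cong (λ n → (m choose k) * (n choose suc i)) suc-q ⟩
      (m choose k) * (p choose suc i)                           ≡⟨ cong ((m choose k) *_) eq ⟩
      (m choose k) * (t * p)                               ≡⟨ *-assoc (m choose k) t p ⟨
      (m choose k) * t * p                                 ≡⟨ cong (_+ (m choose k) * t * p) (nCk≡0ˡ {0} {suc i} (suc m choose k) z<s) ⟨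
      (suc m choose k) * (0 choose suc i) + (m choose k) * t * p     ∎)
  lucas (suc m) zero (suc k) zero _ 0<p =
    subst₂ (λ a b → a choose b ≋ (suc m choose suc k) * (0 choose 0)) (next-block m) (next-block k)
      (pascal (p * m + q) (p * k + q) (lucas m q k q q<p q<p)
              (subst (λ b → (p * m + q) choose b ≋ (m choose suc k) * (q choose 0)) (sym (next-block k))
                (lucas m q (suc k) 0 q<p 0<p))
              (≋-reflexive (begin
                (m choose k) * (q choose q) + (m choose suc k) * (q choose 0)
                  ≡⟨ cong₂ (λ a b → (m choose k) * a + (m choose suc k) * b) (nCn≡1 q) (nC0≡1 q) ⟩
                (m choose k) * 1 + (m choose suc k) * 1
                  ≡⟨ *-distribʳ-+ 1 (m choose k) (m choose suc k) ⟨
                (m choose k + m choose suc k) * 1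
                  ≡⟨ cong (_* 1) (nCk+nC[k+1]≡[n+1]C[k+1] m k) ⟩
                (suc m choose suc k) * 1 ∎)))
    where open ≡-Reasoning
  lucas m (suc j) zero zero _ _ = ≋-reflexive
    (trans (cong ((p * m + suc j) choose_) (cong (_+ 0) (*-zeroʳ p)))
      (trans (nC0≡1 (p * m + suc j)) (sym (cong₂ _*_ (nC0≡1 m) (nC0≡1 (suc j))))))
  lucas m (suc j) k (suc i) j<p i<p =
    subst₂ (λ a b → a choose b ≋ (m choose k) * (suc j choose suc i)) (sym (+-suc (p * m) j)) (sym (+-suc (p * k) i))
      (pascal (p * m + j) (p * k + i) (lucas m j k i (<-trans (n<1+n j) j<p) (<-trans (n<1+n i) i<p))
              (subst (λ b → (p * m + j) choose b ≋ (m choose k) * (j choose suc i)) (+-suc (p * k) i)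
                (lucas m j k (suc i) (<-trans (n<1+n j) j<p) i<p))
              (≋-reflexive (trans (sym (*-distribˡ-+ (m choose k) _ _))
                (cong ((m choose k) *_) (nCk+nC[k+1]≡[n+1]C[k+1] j i)))))
  lucas m (suc j) (suc k) zero j<p 0<p =
    subst₂ (λ a b → a choose b ≋ (m choose suc k) * (suc j choose 0)) (sym (+-suc (p * m) j)) (next-block k)
      (pascal (p * m + j) (p * k + q) (lucas m j k q (<-trans (n<1+n j) j<p) q<p)
              (subst (λ b → (p * m + j) choose b ≋ (m choose suc k) * (j choose 0)) (sym (next-block k))
                (lucas m j (suc k) 0 (<-trans (n<1+n j) j<p) 0<p))
              (≋-reflexive (cong₂ _+_ (nCk≡0ˡ {j} {q} (m choose k) (s≤s⁻¹ (subst (suc j <_) (sym suc-q) j<p)))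
                (cong ((m choose suc k) *_) (trans (nC0≡1 j) (sym (nC0≡1 (suc j))))))))

  nonDiv-≤ : ∀ m j k {i} → i ≤ j → j < p → nonDiv p ((p * m + j) choose (p * k + i)) ≡ nonDiv p (m choose k)
  nonDiv-≤ m j k {i} i≤j j<p with lucas m j k i j<p (≤-<-trans i≤j j<p) | p ∣? (m choose k)
  ... | t , eq | yes d = nonDiv-∣ (subst (p ∣_) (sym eq) (∣m∣n⇒∣m+n (∣m⇒∣m*n (j choose i) d) (n∣m*n t)))
  ... | t , eq | no ¬d = nonDiv-∤ λ d → nondiv (∣m+n∣m⇒∣n (subst (p ∣_) (trans eq (+-comm _ (t * p))) d) (n∣m*n t))
    where
    nondiv : ¬ p ∣ (m choose k) * (j choose i)
    nondiv d with euclidsLemma (m choose k) (j choose i) pp d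
    ... | inj₁ d′ = ¬d d′
    ... | inj₂ d′ = ∤C i≤j j<p d′

  nonDiv-> : ∀ m j k {i} → j < i → i < p → nonDiv p ((p * m + j) choose (p * k + i)) ≡ 0
  nonDiv-> m j k {i} j<i i<p with lucas m j k i (<-trans j<i i<p) i<p
  ... | t , eq = nonDiv-∣ (subst (p ∣_) (sym (trans eq (cong (_+ t * p) (nCk≡0ˡ (m choose k) j<i)))) (n∣m*n t))

  -- By Lucas, the columns `p * k + i` of one block repeat the indicator of `m choose k` for i ≤ j
  -- and are divisible by `p` for i > j.
  row-digit : ∀ m {j} → j < p → row p (p * m + j) ≡ row p m * suc j
  row-digit m {j} j<p = begin
    row p (p * m + j)                                        ≡⟨ row-Σ p (p * m + j) (p * suc m) bound ⟩
    Σ< f (p * suc m)                                         ≡⟨ Σ<-blocks f p (suc m) ⟩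
    Σ< (λ k → Σ< (λ i → f (p * k + i)) p) (suc m)            ≡⟨ Σ<-cong (suc m) (λ {k} _ → block k) ⟩
    Σ< (λ k → nonDiv p (m choose k) * suc j) (suc m)              ≡⟨ Σ<-*ʳ (λ k → nonDiv p (m choose k)) (suc j) (suc m) ⟩
    Σ< (λ k → nonDiv p (m choose k)) (suc m) * suc j              ≡⟨ cong (_* suc j) (row-Σ p m (suc m) ≤-refl) ⟨
    row p m * suc j                                          ∎
    where
    open ≡-Reasoning
    f = λ k → nonDiv p ((p * m + j) choose k)
    bound : p * m + j < p * suc m
    bound = subst (p * m + j <_) (trans (+-comm (p * m) p) (sym (*-suc p m))) (+-monoʳ-< (p * m) j<p)
    block : ∀ k → Σ< (λ i → f (p * k + i)) p ≡ nonDiv p (m choose k) * suc j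
    block k = begin
      Σ< g p                                                  ≡⟨ cong (Σ< g) (m+[n∸m]≡n j<p) ⟨
      Σ< g (suc j + (p ∸ suc j))                              ≡⟨ Σ<-+ g (suc j) (p ∸ suc j) ⟩
      Σ< g (suc j) + Σ< (λ i → g (suc j + i)) (p ∸ suc j)     ≡⟨ cong₂ _+_ low high ⟩
      nonDiv p (m choose k) * suc j + 0                            ≡⟨ +-identityʳ _ ⟩
      nonDiv p (m choose k) * suc j                                ∎
      where
      g = λ i → f (p * k + i)
      low : Σ< g (suc j) ≡ nonDiv p (m choose k) * suc j
      low = trans (Σ<-cong (suc j) λ i<sj → trans (nonDiv-≤ m j k (s≤s⁻¹ i<sj) j<p) (sym (*-identityʳ _)))
        (trans (Σ<-*ˡ (λ _ → 1) (nonDiv p (m choose k)) (suc j))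
               (cong (nonDiv p (m choose k) *_) (Σ<-one (suc j) λ _ → refl)))
      high : Σ< (λ i → g (suc j + i)) (p ∸ suc j) ≡ 0
      high = Σ<-zero (p ∸ suc j) λ {i} i< → nonDiv-> m j k (s≤s (m≤m+n j i))
        (subst (suc j + i <_) (m+[n∸m]≡n j<p) (+-monoʳ-< (suc j) i<))

  F-digit : ∀ n {r} → r ≤ p → F p (p * n + r) ≡ T p * F p n + row p n * tri r
  F-digit zero {zero} _ = trans (cong (λ z → F p (z + 0)) (*-zeroʳ p))
    (sym (cong₂ _+_ (*-zeroʳ (T p)) (*-zeroʳ (row p 0))))
  F-digit (suc n) {zero} _ = begin
    F p (p * suc n + 0)                     ≡⟨ cong (F p) (trans (+-identityʳ _) (trans (*-suc p n) (+-comm p (p * n)))) ⟩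
    F p (p * n + p)                         ≡⟨ F-digit n {p} ≤-refl ⟩
    T p * F p n + row p n * tri p           ≡⟨ cong (λ t → T p * F p n + row p n * t) (T≡tri p) ⟨
    T p * F p n + row p n * T p             ≡⟨ regroup (T p) (F p n) (row p n) (row p (suc n)) ⟩
    T p * (F p n + row p n) + row p (suc n) * 0 ≡⟨ cong (λ z → T p * z + row p (suc n) * 0) (F-suc p n) ⟨
    T p * F p (suc n) + row p (suc n) * 0   ∎
    where
    open ≡-Reasoning
    regroup : ∀ t f r s → t * f + r * t ≡ t * (f + r) + s * 0
    regroup = solve-∀
  F-digit n {suc r} r<p = begin
    F p (p * n + suc r)                              ≡⟨ cong (F p) (+-suc (p * n) r) ⟩
    F p (suc (p * n + r))                            ≡⟨ F-suc p (p * n + r) ⟩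
    F p (p * n + r) + row p (p * n + r)              ≡⟨ cong₂ _+_ (F-digit n (<⇒≤ r<p)) (row-digit n r<p) ⟩
    T p * F p n + row p n * tri r + row p n * suc r  ≡⟨ regroup (T p * F p n) (row p n) (tri r) (suc r) ⟩
    T p * F p n + row p n * (tri r + suc r)          ∎
    where
    open ≡-Reasoning
    regroup : ∀ a b c d → a + b * c + b * d ≡ a + b * (c + d)
    regroup = solve-∀

  row-small : ∀ {r} → r < p → row p r ≡ suc r
  row-small {r} r<p = begin
    row p r              ≡⟨ cong (λ z → row p (z + r)) (*-zeroʳ p) ⟨
    row p (p * 0 + r)    ≡⟨ row-digit 0 r<p ⟩
    row p 0 * suc r      ≡⟨ cong (_* suc r) row0 ⟩
    1 * suc r            ≡⟨ *-identityˡ (suc r) ⟩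
    suc r                ∎
    where
    open ≡-Reasoning
    row0 : row p 0 ≡ 1
    row0 = trans (row-Σ p 0 1 ≤-refl) (nonDiv-∤ {p} {1} (λ d → <⇒≱ 1<p (∣⇒≤ d)))

  F-small : ∀ {r} → r ≤ p → F p r ≡ tri r
  F-small {zero}  _   = refl
  F-small {suc r} r<p = trans (F-suc p r) (cong₂ _+_ (F-small (<⇒≤ r<p)) (row-small r<p))

  F-* : ∀ n → F p (p * n) ≡ T p * F p n
  F-* n = trans (cong (F p) (sym (+-identityʳ (p * n))))
    (trans (F-digit n {0} z≤n) (trans (cong (T p * F p n +_) (*-zeroʳ (row p n))) (+-identityʳ _)))

-- Weighted AM-GM and convexity of powers.

^-distribʳ-* : ∀ m n k → (m * n) ^ k ≡ m ^ k * n ^ k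
^-distribʳ-* m n zero    = refl
^-distribʳ-* m n (suc k) = trans (cong (m * n *_) (^-distribʳ-* m n k)) (exchange m n (m ^ k) (n ^ k))
  where
  exchange : ∀ a b c d → a * b * (c * d) ≡ a * c * (b * d)
  exchange = solve-∀

^-swap : ∀ m k l → (m ^ k) ^ l ≡ (m ^ l) ^ k
^-swap m k l = trans (^-*-assoc m k l) (trans (cong (m ^_) (*-comm k l)) (sym (^-*-assoc m l k)))

^-cancelˡ-≤ : ∀ {m n} k .{{_ : NonZero k}} → m ^ k ≤ n ^ k → m ≤ n
^-cancelˡ-≤ k le = ≮⇒≥ λ n<m → <⇒≱ (^-monoˡ-< k n<m) le

-- (x - y) (x ^ (n + 1) - y ^ (n + 1)) ≥ 0
^-rearrange : ∀ x y n → y * x ^ suc n + x * y ^ suc n ≤ x ^ suc (suc n) + y ^ suc (suc n)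
^-rearrange x y n with ≤-total x y
... | inj₁ x≤y with m≤n⇒∃[o]m+o≡n x≤y | m≤n⇒∃[o]m+o≡n (^-monoˡ-≤ (suc n) x≤y)
...   | (d , refl) | (e , eq) = begin
  (x + d) * a + x * b              ≡⟨ cong (λ z → (x + d) * a + x * z) eq ⟨
  (x + d) * a + x * (a + e)        ≤⟨ m≤m+n _ (d * e) ⟩
  (x + d) * a + x * (a + e) + d * e ≡⟨ regroup x d a e ⟩
  x * a + (x + d) * (a + e)        ≡⟨ cong (λ z → x * a + (x + d) * z) eq ⟩
  x * a + (x + d) * b              ∎
  where
  open ≤-Reasoning
  a = x ^ suc n
  b = (x + d) ^ suc n
  regroup : ∀ x d a e → (x + d) * a + x * (a + e) + d * e ≡ x * a + (x + d) * (a + e)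
  regroup = solve-∀
^-rearrange x y n | inj₂ y≤x with m≤n⇒∃[o]m+o≡n y≤x | m≤n⇒∃[o]m+o≡n (^-monoˡ-≤ (suc n) y≤x)
...   | (d , refl) | (e , eq) = begin
  y * a + (y + d) * b              ≡⟨ cong (λ z → y * z + (y + d) * b) eq ⟨
  y * (b + e) + (y + d) * b        ≤⟨ m≤m+n _ (d * e) ⟩
  y * (b + e) + (y + d) * b + d * e ≡⟨ regroup y d b e ⟩
  (y + d) * (b + e) + y * b        ≡⟨ cong (λ z → (y + d) * z + y * b) eq ⟩
  (y + d) * a + y * b              ∎
  where
  open ≤-Reasoning
  a = (y + d) ^ suc n
  b = y ^ suc n
  regroup : ∀ y d b e → y * (b + e) + (y + d) * b + d * e ≡ (y + d) * (b + e) + y * b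
  regroup = solve-∀

-- A power lies above its tangent at `y`; the negative term is moved across to stay in ℕ. The
-- induction multiplies by `y` and closes with `^-rearrange`.
^-tangent : ∀ x y n → suc n * (y ^ n * x) ≤ x ^ suc n + n * y ^ suc n
^-tangent x y zero    = ≤-reflexive (base x)
  where
  base : ∀ x → 1 * (1 * x) ≡ x * 1 + 0
  base = solve-∀
^-tangent x y (suc n) = begin
  suc (suc n) * (y * b * x)                       ≡⟨ left n x y b ⟩
  y * (suc n * (b * x)) + x * (y * b)             ≤⟨ +-monoˡ-≤ (x * (y * b)) (*-monoʳ-≤ y (^-tangent x y n)) ⟩
  y * (a + n * (y * b)) + x * (y * b)             ≡⟨ middle n x y a b ⟩
  y * a + x * (y * b) + n * (y * (y * b))         ≤⟨ +-monoˡ-≤ (n * (y * (y * b))) (^-rearrange x y n) ⟩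
  x * a + y * (y * b) + n * (y * (y * b))         ≡⟨ +-assoc (x * a) _ _ ⟩
  x * a + suc n * (y * (y * b))                   ∎
  where
  open ≤-Reasoning
  a = x ^ suc n
  b = y ^ n
  left : ∀ n x y b → suc (suc n) * (y * b * x) ≡ y * (suc n * (b * x)) + x * (y * b)
  left = solve-∀
  middle : ∀ n x y a b → y * (a + n * (y * b)) + x * (y * b) ≡ y * a + x * (y * b) + n * (y * (y * b))
  middle = solve-∀

-- A factor `b` joins `n` factors of sum `s`. Up to the common factor n (n + 1), `x` is the new mean
-- and `y` the old one, and the claim is the tangent inequality between them.
AM-GM-step : ∀ s b n .{{_ : NonZero n}} → s ^ n * b * suc n ^ suc n ≤ n ^ n * (s + b) ^ suc n
AM-GM-step s b n = *-cancelˡ-≤ n (+-cancelʳ-≤ (n * y ^ suc n) _ _ (begin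
  n * (s ^ n * b * suc n ^ suc n) + n * y ^ suc n            ≡⟨⟩
  n * (s ^ n * b * (suc n * suc n ^ n)) + n * (y * y ^ n)    ≡⟨ cong (λ z → n * (s ^ n * b * (suc n * suc n ^ n)) + n * (y * z)) (^-distribʳ-* (suc n) s n) ⟩
  n * (s ^ n * b * (suc n * suc n ^ n)) + n * (y * (suc n ^ n * s ^ n)) ≡⟨ split n s b (s ^ n) (suc n ^ n) ⟩
  suc n * (suc n ^ n * s ^ n * x)                            ≡⟨ cong (λ z → suc n * (z * x)) (^-distribʳ-* (suc n) s n) ⟨
  suc n * (y ^ n * x)                                        ≤⟨ ^-tangent x y n ⟩
  x ^ suc n + n * y ^ suc n                                  ≡⟨ cong (_+ n * y ^ suc n) (^-distribʳ-* n (s + b) (suc n)) ⟩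
  n * n ^ n * (s + b) ^ suc n + n * y ^ suc n                ≡⟨ cong (_+ n * y ^ suc n) (*-assoc n _ _) ⟩
  n * (n ^ n * (s + b) ^ suc n) + n * y ^ suc n              ∎))
  where
  open ≤-Reasoning
  x = n * (s + b)
  y = suc n * s
  split : ∀ n s b u w → n * (u * b * (suc n * w)) + n * (suc n * s * (w * u)) ≡ suc n * (w * u * (n * (s + b)))
  split = solve-∀

AM-GM : ∀ a b q d .{{_ : NonZero q}} → a ^ q * b ^ d * (q + d) ^ (q + d) ≤ (q * a + d * b) ^ (q + d)
AM-GM a b q zero rewrite +-identityʳ q | +-identityʳ (q * a) | *-identityʳ (a ^ q) =
  ≤-reflexive (trans (*-comm (a ^ q) (q ^ q)) (sym (^-distribʳ-* q a q)))
AM-GM a b q (suc d) = subst₂ _≤_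
  (cong (λ n → a ^ q * b ^ suc d * n ^ n) (sym (+-suc q d)))
  (cong₂ _^_ (regroup (q * a) (d * b) b) (sym (+-suc q d)))
  (*-cancelˡ-≤ (n ^ n) (begin
    n ^ n * (a ^ q * b ^ suc d * suc n ^ suc n)        ≡⟨ front (n ^ n) (a ^ q) b (b ^ d) (suc n ^ suc n) ⟩
    a ^ q * b ^ d * n ^ n * (b * suc n ^ suc n)        ≤⟨ *-monoˡ-≤ (b * suc n ^ suc n) (AM-GM a b q d) ⟩
    s ^ n * (b * suc n ^ suc n)                        ≡⟨ *-assoc (s ^ n) b _ ⟨
    s ^ n * b * suc n ^ suc n                          ≤⟨ AM-GM-step s b n ⟩
    n ^ n * (s + b) ^ suc n                            ∎))
  where
  open ≤-Reasoning
  n = q + d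
  s = q * a + d * b
  instance
    n≢0 : NonZero n
    n≢0 = >-nonZero (≤-trans (>-nonZero⁻¹ q) (m≤m+n q d))
    n^n≢0 : NonZero (n ^ n)
    n^n≢0 = m^n≢0 n n
  regroup : ∀ x y b → x + y + b ≡ x + (b + y)
  regroup = solve-∀
  front : ∀ w u b v z → w * (u * (b * v) * z) ≡ u * v * w * (b * z)
  front = solve-∀

-- Convexity of the region U y ^ P ≤ V c ^ Q, P ≥ Q, with unnormalised weights.
module Convexity (U V Q d y₀ c₀ y₁ c₁ λ₀ λ₁ : ℕ) .{{_ : NonZero Q}} where

  private
    P = Q + d
    S = λ₀ + λ₁
    Y = λ₀ * y₀ + λ₁ * y₁
    C = λ₀ * c₀ + λ₁ * c₁
    τ : ℕ → ℕ
    τ c = Q * (S * c) + d * C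

    -- By weighted AM-GM, (S c) ^ Q * C ^ d ≤ (τ c / P) ^ P; the second hypothesis
    -- selects the endpoint at which y / τ c is largest.
    at-endpoint : ∀ {y c} .{{_ : NonZero (S * c)}} → U * y ^ P ≤ V * c ^ Q →
      Y * τ c ≤ y * (P * (S * C)) → U * Y ^ P ≤ V * C ^ Q * S ^ d
    at-endpoint {y} {c} le steep = *-cancelʳ-≤ _ _ (τ c ^ P) (begin
      U * Y ^ P * τ c ^ P                               ≡⟨ *-assoc U _ _ ⟩
      U * (Y ^ P * τ c ^ P)                             ≡⟨ cong (U *_) (^-distribʳ-* Y (τ c) P) ⟨
      U * (Y * τ c) ^ P                                 ≤⟨ *-monoʳ-≤ U (^-monoˡ-≤ P steep) ⟩
      U * (y * (P * (S * C))) ^ P                       ≡⟨ cong (U *_) expand ⟩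
      U * (y ^ P * (P ^ P * (S ^ Q * S ^ d * (C ^ Q * C ^ d))))  ≡⟨ front U (y ^ P) (P ^ P) (S ^ Q) (S ^ d) (C ^ Q) (C ^ d) ⟩
      U * y ^ P * (S ^ Q * C ^ d * P ^ P * (C ^ Q * S ^ d))      ≤⟨ *-monoˡ-≤ _ le ⟩
      V * c ^ Q * (S ^ Q * C ^ d * P ^ P * (C ^ Q * S ^ d))      ≡⟨ back V (c ^ Q) (S ^ Q) (C ^ d) (P ^ P) (C ^ Q) (S ^ d) ⟩
      V * C ^ Q * S ^ d * (S ^ Q * c ^ Q * C ^ d * P ^ P)        ≡⟨ cong (λ z → V * C ^ Q * S ^ d * (z * C ^ d * P ^ P)) (^-distribʳ-* S c Q) ⟨
      V * C ^ Q * S ^ d * ((S * c) ^ Q * C ^ d * P ^ P)          ≤⟨ *-monoʳ-≤ (V * C ^ Q * S ^ d) (AM-GM (S * c) C Q d) ⟩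
      V * C ^ Q * S ^ d * τ c ^ P                       ∎)
      where
      open ≤-Reasoning
      instance
        τ^P≢0 : NonZero (τ c ^ P)
        τ^P≢0 = m^n≢0 (τ c) P {{>-nonZero (≤-trans (>-nonZero⁻¹ (Q * (S * c)) {{m*n≢0 Q (S * c)}}) (m≤m+n _ (d * C)))}}
      expand : (y * (P * (S * C))) ^ P ≡ y ^ P * (P ^ P * (S ^ Q * S ^ d * (C ^ Q * C ^ d)))
      expand = trans (^-distribʳ-* y _ P) (cong (y ^ P *_) (trans (^-distribʳ-* P _ P) (cong (P ^ P *_)
        (trans (^-distribʳ-* S C P) (cong₂ _*_ (^-distribˡ-+-* S Q d) (^-distribˡ-+-* C Q d))))))
      front : ∀ u y p s s′ c c′ → u * (y * (p * (s * s′ * (c * c′)))) ≡ u * y * (s * c′ * p * (c * s′))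
      front = solve-∀
      back : ∀ v e s c′ p c s′ → v * e * (s * c′ * p * (c * s′)) ≡ v * c * s′ * (s * e * c′ * p)
      back = solve-∀

  -- Since τ is affine, λ₀ τ(c₀) + λ₁ τ(c₁) = P S C. Hence Y / (P S C) is a weighted mediant of y₀ /
  -- τ(c₀) and y₁ / τ(c₁) and does not exceed the larger of the two, which is what `at-endpoint`
  -- needs.
  convex : .{{_ : NonZero S}} .{{_ : NonZero c₀}} .{{_ : NonZero c₁}} →
    U * y₀ ^ P ≤ V * c₀ ^ Q → U * y₁ ^ P ≤ V * c₁ ^ Q → U * Y ^ P ≤ V * C ^ Q * S ^ d
  convex le₀ le₁ with ≤-total (y₁ * τ c₀) (y₀ * τ c₁)
  ... | inj₁ h = at-endpoint {{m*n≢0 S c₀}} le₀ (begin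
    Y * τ c₀                                       ≡⟨ left λ₀ y₀ λ₁ y₁ (τ c₀) ⟩
    λ₀ * y₀ * τ c₀ + λ₁ * (y₁ * τ c₀)              ≤⟨ +-monoʳ-≤ (λ₀ * y₀ * τ c₀) (*-monoʳ-≤ λ₁ h) ⟩
    λ₀ * y₀ * τ c₀ + λ₁ * (y₀ * τ c₁)              ≡⟨ total Q d λ₀ c₀ λ₁ c₁ y₀ ⟩
    y₀ * (P * (S * C))                             ∎)
    where
    open ≤-Reasoning
    left : ∀ l y l′ y′ t → (l * y + l′ * y′) * t ≡ l * y * t + l′ * (y′ * t)
    left = solve-∀
    total : ∀ Q d l c l′ c′ y →
      l * y * (Q * ((l + l′) * c) + d * (l * c + l′ * c′)) + l′ * (y * (Q * ((l + l′) * c′) + d * (l * c + l′ * c′)))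
        ≡ y * ((Q + d) * ((l + l′) * (l * c + l′ * c′)))
    total = solve-∀
  ... | inj₂ h = at-endpoint {{m*n≢0 S c₁}} le₁ (begin
    Y * τ c₁                                       ≡⟨ left λ₀ y₀ λ₁ y₁ (τ c₁) ⟩
    λ₀ * (y₀ * τ c₁) + λ₁ * y₁ * τ c₁              ≤⟨ +-monoˡ-≤ (λ₁ * y₁ * τ c₁) (*-monoʳ-≤ λ₀ h) ⟩
    λ₀ * (y₁ * τ c₀) + λ₁ * y₁ * τ c₁              ≡⟨ total Q d λ₀ c₀ λ₁ c₁ y₁ ⟩
    y₁ * (P * (S * C))                             ∎)
    where
    open ≤-Reasoning
    left : ∀ l y l′ y′ t → (l * y + l′ * y′) * t ≡ l * (y * t) + l′ * y′ * t
    left = solve-∀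
    total : ∀ Q d l c l′ c′ y →
      l * (y * (Q * ((l + l′) * c) + d * (l * c + l′ * c′))) + l′ * y * (Q * ((l + l′) * c′) + d * (l * c + l′ * c′))
        ≡ y * ((Q + d) * ((l + l′) * (l * c + l′ * c′)))
    total = solve-∀

-- Replacing the irrational exponent by a rational one.

-- In the notation of `Le`, with all rationals cleared:  A X ^ (-ϱ) ≤ c y ^ (-ϱ),
-- where ϱ = log T / log p.
Dominates : (p T A X c y : ℕ) → Set
Dominates p T A X c y = ∀ k m v → 1 ≤ v → p ^ k * X ^ v < y ^ v * p ^ m → T ^ k * A ^ v < c ^ v * T ^ m

module Exponent {p T A X c y P Q : ℕ}
  .{{_ : NonZero p}} .{{_ : NonZero A}} .{{_ : NonZero P}} .{{_ : NonZero Q}}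
  (1<T : 1 < T) (le : y ^ P * A ^ Q ≤ c ^ Q * X ^ P) where

  private
    instance
      T≢0 : NonZero T
      T≢0 = >-nonZero (<-trans z<s 1<T)

    le-^ : ∀ v → (y ^ v) ^ P * (A ^ v) ^ Q ≤ (c ^ v) ^ Q * (X ^ v) ^ P
    le-^ v = subst₂ _≤_
      (trans (^-distribʳ-* (y ^ P) (A ^ Q) v) (cong₂ _*_ (^-swap y P v) (^-swap A Q v)))
      (trans (^-distribʳ-* (c ^ Q) (X ^ P) v) (cong₂ _*_ (^-swap c Q v) (^-swap X P v)))
      (^-monoˡ-≤ v le)

  -- Let w = (k - m) / v be the cut; `le` says (y / X) ^ (P / Q) ≤ c / A. For w < 0 it is enough
  -- that A ≤ c. For w ≥ 0 a failure would give c / A ≤ T ^ w ≤ p ^ (w P / Q) < (y / X) ^ (P / Q);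
  -- the sign of w is what makes an upper bound for ϱ the right one.
  dominates-right : T ^ Q ≤ p ^ P → X ≤ y → Dominates p T A X c y
  dominates-right ϱ≤ X≤y k m v 1≤v hyp with m ≤? k
  ... | no m≰k = begin-strict
    T ^ k * A ^ v     ≤⟨ *-monoʳ-≤ (T ^ k) (^-monoˡ-≤ v A≤c) ⟩
    T ^ k * c ^ v     <⟨ *-monoˡ-< (c ^ v) {{m^n≢0 c v {{c≢0}}}} (^-monoʳ-< T 1<T (≰⇒> m≰k)) ⟩
    T ^ m * c ^ v     ≡⟨ *-comm (T ^ m) (c ^ v) ⟩
    c ^ v * T ^ m     ∎
    where
    open ≤-Reasoning
    y≢0 : NonZero y
    y≢0 = ≢-nonZero λ { refl → case-zero v 1≤v hyp }
      where
      case-zero : ∀ v → 1 ≤ v → ¬ (p ^ k * X ^ v < 0 ^ v * p ^ m)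
      case-zero (suc v) _ ()
    A≤c : A ≤ c
    A≤c = ^-cancelˡ-≤ Q (*-cancelˡ-≤ (y ^ P) {{m^n≢0 y P {{y≢0}}}}
      (≤-trans le (≤-trans (*-monoʳ-≤ (c ^ Q) (^-monoˡ-≤ P X≤y)) (≤-reflexive (*-comm (c ^ Q) (y ^ P))))))
    c≢0 : NonZero c
    c≢0 = >-nonZero (≤-trans (>-nonZero⁻¹ A) A≤c)
  ... | yes m≤k with m≤n⇒∃[o]m+o≡n m≤k
  ...   | (d , refl) = ≰⇒> λ neg → <-irrefl refl (begin-strict
    (y ^ v) ^ P * (A ^ v) ^ Q                   ≤⟨ le-^ v ⟩
    (c ^ v) ^ Q * (X ^ v) ^ P                   ≤⟨ *-monoˡ-≤ ((X ^ v) ^ P) (^-monoˡ-≤ Q (cancel neg)) ⟩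
    (T ^ d * A ^ v) ^ Q * (X ^ v) ^ P           ≡⟨ cong (_* (X ^ v) ^ P) (trans (^-distribʳ-* (T ^ d) (A ^ v) Q) (cong (_* (A ^ v) ^ Q) (^-swap T d Q))) ⟩
    (T ^ Q) ^ d * (A ^ v) ^ Q * (X ^ v) ^ P     ≤⟨ *-monoˡ-≤ ((X ^ v) ^ P) (*-monoˡ-≤ ((A ^ v) ^ Q) (^-monoˡ-≤ d ϱ≤)) ⟩
    (p ^ P) ^ d * (A ^ v) ^ Q * (X ^ v) ^ P     ≡⟨ exchange ((p ^ P) ^ d) ((A ^ v) ^ Q) ((X ^ v) ^ P) ⟩
    (p ^ P) ^ d * (X ^ v) ^ P * (A ^ v) ^ Q     ≡⟨ cong (_* (A ^ v) ^ Q) (trans (^-distribʳ-* (p ^ d) (X ^ v) P) (cong (_* (X ^ v) ^ P) (^-swap p d P))) ⟨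
    (p ^ d * X ^ v) ^ P * (A ^ v) ^ Q           <⟨ *-monoˡ-< ((A ^ v) ^ Q) {{m^n≢0 (A ^ v) Q {{m^n≢0 A v}}}} (^-monoˡ-< P hyp′) ⟩
    (y ^ v) ^ P * (A ^ v) ^ Q                   ∎)
    where
    open ≤-Reasoning
    exchange : ∀ a b c → a * b * c ≡ a * c * b
    exchange = solve-∀
    hyp′ : p ^ d * X ^ v < y ^ v
    hyp′ = *-cancelˡ-< (p ^ m) _ _ (subst₂ _<_
      (trans (cong (_* X ^ v) (^-distribˡ-+-* p m d)) (*-assoc (p ^ m) _ _)) (*-comm (y ^ v) (p ^ m)) hyp)
    cancel : c ^ v * T ^ m ≤ T ^ (m + d) * A ^ v → c ^ v ≤ T ^ d * A ^ v
    cancel neg = *-cancelˡ-≤ (T ^ m) {{m^n≢0 T m}} (subst₂ _≤_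
      (*-comm (c ^ v) (T ^ m)) (trans (cong (_* A ^ v) (^-distribˡ-+-* T m d)) (*-assoc (T ^ m) _ _)) neg)

  -- Here y / X ≤ 1, so only cuts w < 0 satisfy the hypothesis. A negative exponent reverses the
  -- comparison of T with a power of `p`, and a lower bound for ϱ is used instead.
  dominates-left : p ^ P ≤ T ^ Q → y ≤ X → Dominates p T A X c y
  dominates-left ≤ϱ y≤X k m v 1≤v hyp with m ≤? k
  ... | yes m≤k = contradiction hyp (≤⇒≯ (begin
    y ^ v * p ^ m     ≤⟨ *-mono-≤ (^-monoˡ-≤ v y≤X) (^-monoʳ-≤ p m≤k) ⟩
    X ^ v * p ^ k     ≡⟨ *-comm (X ^ v) (p ^ k) ⟩
    p ^ k * X ^ v     ∎))
    where open ≤-Reasoning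
  ... | no m≰k with m≤n⇒∃[o]m+o≡n (<⇒≤ (≰⇒> m≰k))
  ...   | (d , refl) = ≰⇒> λ neg → <-irrefl refl (begin-strict
    (y ^ v * p ^ d) ^ P * (A ^ v) ^ Q           ≡⟨ cong (_* (A ^ v) ^ Q) (trans (^-distribʳ-* (y ^ v) (p ^ d) P) (cong ((y ^ v) ^ P *_) (^-swap p d P))) ⟩
    (y ^ v) ^ P * (p ^ P) ^ d * (A ^ v) ^ Q     ≡⟨ exchange ((y ^ v) ^ P) ((p ^ P) ^ d) ((A ^ v) ^ Q) ⟩
    (y ^ v) ^ P * (A ^ v) ^ Q * (p ^ P) ^ d     ≤⟨ *-mono-≤ (le-^ v) (^-monoˡ-≤ d ≤ϱ) ⟩
    (c ^ v) ^ Q * (X ^ v) ^ P * (T ^ Q) ^ d     ≡⟨ exchange ((c ^ v) ^ Q) ((X ^ v) ^ P) ((T ^ Q) ^ d) ⟩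
    (c ^ v) ^ Q * (T ^ Q) ^ d * (X ^ v) ^ P     ≡⟨ cong (_* (X ^ v) ^ P) (trans (^-distribʳ-* (c ^ v) (T ^ d) Q) (cong ((c ^ v) ^ Q *_) (^-swap T d Q))) ⟨
    (c ^ v * T ^ d) ^ Q * (X ^ v) ^ P           ≤⟨ *-monoˡ-≤ ((X ^ v) ^ P) (^-monoˡ-≤ Q (cancel neg)) ⟩
    (A ^ v) ^ Q * (X ^ v) ^ P                   <⟨ *-monoʳ-< ((A ^ v) ^ Q) {{m^n≢0 (A ^ v) Q {{m^n≢0 A v}}}} (^-monoˡ-< P hyp′) ⟩
    (A ^ v) ^ Q * (y ^ v * p ^ d) ^ P           ≡⟨ *-comm ((A ^ v) ^ Q) _ ⟩
    (y ^ v * p ^ d) ^ P * (A ^ v) ^ Q           ∎)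
    where
    open ≤-Reasoning
    exchange : ∀ a b c → a * b * c ≡ a * c * b
    exchange = solve-∀
    front : ∀ a b c → a * (b * c) ≡ b * (a * c)
    front = solve-∀
    hyp′ : X ^ v < y ^ v * p ^ d
    hyp′ = *-cancelˡ-< (p ^ k) _ _ (subst (p ^ k * X ^ v <_)
      (trans (cong (y ^ v *_) (^-distribˡ-+-* p k d)) (front (y ^ v) (p ^ k) (p ^ d))) hyp)
    cancel : c ^ v * T ^ (k + d) ≤ T ^ k * A ^ v → c ^ v * T ^ d ≤ A ^ v
    cancel neg = *-cancelˡ-≤ (T ^ k) {{m^n≢0 T k}} (subst (_≤ T ^ k * A ^ v)
      (trans (cong (c ^ v *_) (^-distribˡ-+-* T k d)) (front (c ^ v) (T ^ k) (T ^ d))) neg)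

-- Base p expansions and self-similarity on blocks.

n<m^n : ∀ {m} → 1 < m → ∀ n → n < m ^ n
n<m^n 1<m zero            = z<s
n<m^n {m} 1<m (suc n) = begin-strict
  suc n          ≤⟨ n<m^n 1<m n ⟩
  m ^ n          ≡⟨ *-identityˡ (m ^ n) ⟨
  1 * m ^ n      <⟨ *-monoˡ-< (m ^ n) {{>-nonZero (≤-<-trans z≤n (n<m^n 1<m n))}} 1<m ⟩
  m * m ^ n      ∎
  where open ≤-Reasoning

digit-split : ∀ u b .{{_ : NonZero b}} → ∃[ q ] ∃[ s ] (s < b × u ≡ b * q + s)
digit-split u b = u div b , u % b , m%n<n u b ,
  trans (m≡m%n+[m/n]*n u b) (trans (+-comm (u % b) _) (cong (_+ u % b) (*-comm (u div b) b)))

-- The cells are closed, and a positive multiple of `M` goes to the cell on its left. Thus the right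
-- end `suc r * M` still has top digit `r`.
digit-split-≤ : ∀ r M u → u ≤ suc r * M → ∃[ s ] ∃[ u′ ] (s ≤ r × u′ ≤ M × u ≡ M * s + u′)
digit-split-≤ r M u u≤ with u ≤? M
... | yes u≤M = 0 , u , z≤n , u≤M , cong (_+ u) (sym (*-zeroʳ M))
digit-split-≤ zero M u u≤ | no u≰M = contradiction (subst (u ≤_) (*-identityˡ M) u≤) u≰M
digit-split-≤ (suc r) M u u≤ | no u≰M with m≤n⇒∃[o]m+o≡n (<⇒≤ (≰⇒> u≰M))
... | (w , refl) with digit-split-≤ r M w (+-cancelˡ-≤ M _ _ u≤)
...   | (s , u′ , s≤r , u′≤M , refl) = suc s , u′ , s≤s s≤r , u′≤M ,
  trans (sym (+-assoc M (M * s) u′)) (cong (_+ u′) (sym (*-suc M s)))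

leading-digit : ∀ b → 1 < b → ∀ n → 1 ≤ n → ∃[ j ] ∃[ i ] ∃[ u ] (1 ≤ i × i < b × u < b ^ j × n ≡ b ^ j * i + u)
leading-digit b 1<b n 1≤n = go n (n<m^n 1<b n)
  where
  instance
    b≢0 : NonZero b
    b≢0 = >-nonZero (<-trans z<s 1<b)
  go : ∀ k → n < b ^ k → ∃[ j ] ∃[ i ] ∃[ u ] (1 ≤ i × i < b × u < b ^ j × n ≡ b ^ j * i + u)
  go zero    n<1 = contradiction 1≤n (<⇒≱ n<1)
  go (suc k) n<b^ with n <? b ^ k
  ... | yes n<   = go k n<
  ... | no  n≮ with digit-split n (b ^ k) {{m^n≢0 b k}}
  ...   | (i , u , u< , eq) = k , i , u , 1≤i i eq , i<b , u< , eq
    where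
    1≤i : ∀ i → n ≡ b ^ k * i + u → 1 ≤ i
    1≤i zero    eq = contradiction (subst (_< b ^ k) (sym (trans eq (cong (_+ u) (*-zeroʳ (b ^ k))))) u<) n≮
    1≤i (suc i) eq = z<s
    i<b : i < b
    i<b = *-cancelˡ-< (b ^ k) i b (≤-<-trans (m≤m+n _ u) (subst₂ _<_ eq (*-comm b (b ^ k)) n<b^))

module Blocks {p : ℕ} (pp : Prime p) where

  open Lucas pp

  private instance
    p≢0′ : NonZero p
    p≢0′ = prime⇒nonZero pp

  T≢0 : NonZero (T p)
  T≢0 = subst NonZero (sym (T≡tri p)) (go p)
    where
    go : ∀ n .{{_ : NonZero n}} → NonZero (tri n)
    go (suc n) = >-nonZero (≤-trans z<s (m≤n+m (suc n) (tri n)))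

  private
    regroup : ∀ j r q s → p ^ suc j * r + (p * q + s) ≡ p * (p ^ j * r + q) + s
    regroup j r q s = identity p (p ^ j) r q s
      where
      identity : ∀ p b r q s → p * b * r + (p * q + s) ≡ p * (b * r + q) + s
      identity = solve-∀

  row-block : ∀ r j {u} → u < p ^ j → row p (p ^ j * r + u) ≡ row p r * row p u
  row-block r zero {zero} _ = begin
    row p (1 * r + 0)      ≡⟨ cong (row p) (trans (+-identityʳ _) (*-identityˡ r)) ⟩
    row p r                ≡⟨ *-identityʳ (row p r) ⟨
    row p r * 1            ≡⟨ cong (row p r *_) (row-small (>-nonZero⁻¹ p)) ⟨
    row p r * row p 0      ∎
    where open ≡-Reasoning
  row-block r zero {suc u} (s≤s ())
  row-block r (suc j) {u} u< with digit-split u p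
  ... | (q , s , s<p , refl) = begin
    row p (p ^ suc j * r + (p * q + s))   ≡⟨ cong (row p) (regroup j r q s) ⟩
    row p (p * (p ^ j * r + q) + s)       ≡⟨ row-digit (p ^ j * r + q) s<p ⟩
    row p (p ^ j * r + q) * suc s         ≡⟨ cong (_* suc s) (row-block r j q<) ⟩
    row p r * row p q * suc s             ≡⟨ *-assoc (row p r) (row p q) (suc s) ⟩
    row p r * (row p q * suc s)           ≡⟨ cong (row p r *_) (row-digit q s<p) ⟨
    row p r * row p (p * q + s)           ∎
    where
    open ≡-Reasoning
    q< : q < p ^ j
    q< = *-cancelˡ-< p q (p ^ j) (≤-<-trans (m≤m+n (p * q) s) u<)

  -- This is ψ(r + t) = F(r) + row(r) ψ(t) at t = u / p ^ j without denominators. The induction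
  -- removes the last digit of `u`.
  F-block : ∀ r j {u} → u ≤ p ^ j → F p (p ^ j * r + u) ≡ T p ^ j * F p r + row p r * F p u
  F-block r zero {zero} _ = trans (cong (F p) (trans (+-identityʳ _) (*-identityˡ r)))
    (sym (trans (cong₂ _+_ (*-identityˡ (F p r)) (*-zeroʳ (row p r))) (+-identityʳ (F p r))))
  F-block r zero {suc zero} _ = begin
    F p (1 * r + 1)                   ≡⟨ cong (F p) (trans (+-comm (1 * r) 1) (cong suc (*-identityˡ r))) ⟩
    F p (suc r)                       ≡⟨ F-suc p r ⟩
    F p r + row p r                   ≡⟨ cong₂ _+_ (*-identityˡ (F p r)) (*-identityʳ (row p r)) ⟨
    1 * F p r + row p r * 1           ≡⟨ cong (λ z → 1 * F p r + row p r * z) (F-small (<⇒≤ 1<p)) ⟨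
    1 * F p r + row p r * F p 1       ∎
    where open ≡-Reasoning
  F-block r zero {suc (suc u)} (s≤s ())
  F-block r (suc j) {u} u≤ with digit-split u p
  ... | (q , s , s<p , refl) = begin
    F p (p ^ suc j * r + (p * q + s))                        ≡⟨ cong (F p) (regroup j r q s) ⟩
    F p (p * (p ^ j * r + q) + s)                            ≡⟨ F-digit (p ^ j * r + q) (<⇒≤ s<p) ⟩
    T p * F p (p ^ j * r + q) + row p (p ^ j * r + q) * tri s
      ≡⟨ cong₂ (λ x y → T p * x + y) (F-block r j q≤) last ⟩
    T p * (T p ^ j * F p r + row p r * F p q) + row p r * (row p q * tri s)
      ≡⟨ collect (T p) (T p ^ j) (F p r) (row p r) (F p q) (row p q * tri s) ⟩
    T p * T p ^ j * F p r + row p r * (T p * F p q + row p q * tri s)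
      ≡⟨ cong (λ z → T p ^ suc j * F p r + row p r * z) (F-digit q (<⇒≤ s<p)) ⟨
    T p ^ suc j * F p r + row p r * F p (p * q + s)          ∎
    where
    open ≡-Reasoning
    q≤ : q ≤ p ^ j
    q≤ = *-cancelˡ-≤ p (≤-trans (m≤m+n (p * q) s) u≤)
    collect : ∀ t tj f r g w → t * (tj * f + r * g) + r * w ≡ t * tj * f + r * (t * g + w)
    collect = solve-∀
    last : row p (p ^ j * r + q) * tri s ≡ row p r * (row p q * tri s)
    last with m≤n⇒m<n∨m≡n q≤
    ... | inj₁ q<   = trans (cong (_* tri s) (row-block r j q<)) (*-assoc (row p r) (row p q) (tri s))
    -- At q = p ^ j the hypothesis of `row-block` fails, but then u = p ^ suc j forces s = 0 and the
    -- factor `tri s` kills both sides.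
    ... | inj₂ refl with n≤0⇒n≡0 {s} (+-cancelˡ-≤ (p * p ^ j) s 0 (≤-trans u≤ (≤-reflexive (sym (+-identityʳ _)))))
    ...   | refl = trans (*-zeroʳ (row p (p ^ j * r + q)))
      (sym (trans (cong (row p r *_) (*-zeroʳ (row p q))) (*-zeroʳ (row p r))))

-- The lower envelope of ψ.

-- The numbers produced are weights of total `M`: `d` and `2 * u` write u as a mean of 0 and M / 2,
-- while `2 * g` and `d` write it as a mean of M / 2 and M.
halves : ∀ {M u} → u ≤ M → (∃[ d ] d + 2 * u ≡ M) ⊎ (∃[ g ] ∃[ d ] (2 * g + d ≡ M × g + d ≡ u))
halves {M} {u} u≤M with m≤n⇒∃[o]m+o≡n u≤M
... | (g , refl) with ≤-total u g
...   | inj₁ u≤g with m≤n⇒∃[o]m+o≡n u≤g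
...     | (d , refl) = inj₁ (d , total d u)
  where
  total : ∀ d u → d + 2 * u ≡ u + (u + d)
  total = solve-∀
halves u≤M | (g , refl) | inj₂ g≤u with m≤n⇒∃[o]m+o≡n g≤u
...     | (d , refl) = inj₂ (g , d , total g d , refl)
  where
  total : ∀ g d → 2 * g + d ≡ g + d + g
  total = solve-∀

-- With M = p ^ j, `Line C j u` says F p u / T ^ j ≥ 1/4 + (C / e) (u / M - 1/2).
-- The two slopes C⁻ < C⁺ give a corner at u = M / 2.  A top digit r reduces the
-- claim for j + 1 to an affine inequality in the remainder u′, which is checked
-- at u′ = 0, M / 2 and M.
module Slopes (p e C⁻ C⁺ : ℕ) where

  private
    t = T p

  gap : ℕ → ℕ → ℕ
  gap C r = 4 * e * p * tri r + p * suc r * e + 2 * C * p * t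

  -- At M / 2 the inner line has height 1/4 whatever its slope, so C⁻ and C⁺ are absent from the
  -- second condition. For p = 2h + 1 and r = h that condition is an equality.
  DigitCheck : ℕ → ℕ → Set
  DigitCheck C r =
      t * (e * p + 4 * C * r) + 2 * p * suc r * C⁻ ≤ gap C r
    × t * (e * p + 4 * C * r + 2 * C) ≤ gap C r
    × t * (e * p + 4 * C * r + 4 * C) ≤ gap C r + 2 * p * suc r * C⁺

  -- The first two conditions are the induction base j = 0: the line passes on or below (0 , 0) and
  -- (1 , 1).
  SlopeCheck : ℕ → Set
  SlopeCheck C = e ≤ 2 * C × 2 * C ≤ 3 * e × (∀ {r} → r < p → DigitCheck C r)

  Line : ℕ → ℕ → ℕ → Set
  Line C j u = t ^ j * (e * p ^ j + 4 * C * u) ≤ 4 * e * p ^ j * F p u + 2 * C * p ^ j * t ^ j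

  slope? : ∀ C → Dec (SlopeCheck C)
  slope? C = (e ≤? 2 * C) ×-dec (2 * C ≤? 3 * e)
    ×-dec allUpTo? (λ r → (_ ≤? _) ×-dec (_ ≤? _) ×-dec (_ ≤? _)) p

module Envelope {p : ℕ} (pp : Prime p) (e C⁻ C⁺ : ℕ) where

  open Lucas pp
  open Blocks pp
  open Slopes p e C⁻ C⁺

  private
    t = T p
    instance
      p≢0′ : NonZero p
      p≢0′ = prime⇒nonZero pp

  private
    line-zero : ∀ C → SlopeCheck C → ∀ {u} → u ≤ 1 → Line C 0 u
    line-zero C (lo , hi , _) {zero} _ = begin
      1 * (e * 1 + 4 * C * 0)           ≡⟨ lhs e C ⟩
      e                                 ≤⟨ lo ⟩
      2 * C                             ≡⟨ rhs e C ⟨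
      4 * e * 1 * 0 + 2 * C * 1 * 1     ∎
      where
      open ≤-Reasoning
      lhs : ∀ e C → 1 * (e * 1 + 4 * C * 0) ≡ e
      lhs = solve-∀
      rhs : ∀ e C → 4 * e * 1 * 0 + 2 * C * 1 * 1 ≡ 2 * C
      rhs = solve-∀
    line-zero C (lo , hi , _) {suc zero} _ = begin
      1 * (e * 1 + 4 * C * 1)               ≡⟨ lhs e C ⟩
      e + 2 * C + 2 * C                     ≤⟨ +-monoˡ-≤ (2 * C) (+-monoʳ-≤ e hi) ⟩
      e + 3 * e + 2 * C                     ≡⟨ rhs e C ⟩
      4 * e * 1 * 1 + 2 * C * 1 * 1         ≡⟨ cong (λ z → 4 * e * 1 * z + 2 * C * 1 * 1) (F-small (<⇒≤ 1<p)) ⟨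
      4 * e * 1 * F p 1 + 2 * C * 1 * 1     ∎
      where
      open ≤-Reasoning
      lhs : ∀ e C → 1 * (e * 1 + 4 * C * 1) ≡ e + 2 * C + 2 * C
      lhs = solve-∀
      rhs : ∀ e C → e + 3 * e + 2 * C ≡ 4 * e * 1 * 1 + 2 * C * 1 * 1
      rhs = solve-∀
    line-zero C _ {suc (suc u)} (s≤s ())

    line-suc : ∀ C C′ j {r u} → r < p → u ≤ p ^ j → Line C′ j u →
      t * (e * p * p ^ j + 4 * C * (p ^ j * r + u)) + 2 * p * suc r * C′ * p ^ j
        ≤ 4 * e * p * p ^ j * tri r + p * suc r * (e * p ^ j + 4 * C′ * u) + 2 * C * p * p ^ j * t →
      Line C (suc j) (p ^ j * r + u)
    line-suc C C′ j {r} {u} r<p u≤ line affine = +-cancelʳ-≤ (p * suc r * (2 * C′ * M * tj)) _ _ (begin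
      t * tj * (e * (p * M) + 4 * C * (M * r + u)) + p * suc r * (2 * C′ * M * tj)
        ≡⟨ lhs t tj e p M C r u C′ ⟩
      tj * (t * (e * p * M + 4 * C * (M * r + u)) + 2 * p * suc r * C′ * M)
        ≤⟨ *-monoʳ-≤ tj affine ⟩
      tj * (4 * e * p * M * tri r + p * suc r * (e * M + 4 * C′ * u) + 2 * C * p * M * t)
        ≡⟨ middle t tj e p M C r u C′ (tri r) ⟩
      tj * (4 * e * p * M * tri r + 2 * C * p * M * t) + p * suc r * (tj * (e * M + 4 * C′ * u))
        ≤⟨ +-monoʳ-≤ (tj * (4 * e * p * M * tri r + 2 * C * p * M * t)) (*-monoʳ-≤ (p * suc r) line) ⟩
      tj * (4 * e * p * M * tri r + 2 * C * p * M * t) + p * suc r * (4 * e * M * F p u + 2 * C′ * M * tj)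
        ≡⟨ rhs t tj e p M C r C′ (tri r) (F p u) ⟩
      4 * e * (p * M) * (tj * tri r + suc r * F p u) + 2 * C * (p * M) * (t * tj) + p * suc r * (2 * C′ * M * tj)
        ≡⟨ cong (λ z → 4 * e * (p * M) * z + 2 * C * (p * M) * (t * tj) + p * suc r * (2 * C′ * M * tj)) value ⟨
      4 * e * (p * M) * F p (M * r + u) + 2 * C * (p * M) * (t * tj) + p * suc r * (2 * C′ * M * tj) ∎)
      where
      open ≤-Reasoning
      tj = t ^ j
      M = p ^ j
      value : F p (M * r + u) ≡ tj * tri r + suc r * F p u
      value = trans (F-block r j u≤) (cong₂ (λ x y → tj * x + y * F p u) (F-small (<⇒≤ r<p)) (row-small r<p))
      lhs : ∀ t tj e p M C r u C′ →
        t * tj * (e * (p * M) + 4 * C * (M * r + u)) + p * suc r * (2 * C′ * M * tj)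
          ≡ tj * (t * (e * p * M + 4 * C * (M * r + u)) + 2 * p * suc r * C′ * M)
      lhs = solve-∀
      middle : ∀ t tj e p M C r u C′ f →
        tj * (4 * e * p * M * f + p * suc r * (e * M + 4 * C′ * u) + 2 * C * p * M * t)
          ≡ tj * (4 * e * p * M * f + 2 * C * p * M * t) + p * suc r * (tj * (e * M + 4 * C′ * u))
      middle = solve-∀
      rhs : ∀ t tj e p M C r C′ f g →
        tj * (4 * e * p * M * f + 2 * C * p * M * t) + p * suc r * (4 * e * M * g + 2 * C′ * M * tj)
          ≡ 4 * e * (p * M) * (tj * f + suc r * g) + 2 * C * (p * M) * (t * tj) + p * suc r * (2 * C′ * M * tj)
      rhs = solve-∀

    affine-left : ∀ C {r} M u d → d + 2 * u ≡ M → DigitCheck C r →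
      t * (e * p * M + 4 * C * (M * r + u)) + 2 * p * suc r * C⁻ * M
        ≤ 4 * e * p * M * tri r + p * suc r * (e * M + 4 * C⁻ * u) + 2 * C * p * M * t
    affine-left C {r} _ u d refl (left , mid , _) = begin
      t * (e * p * (d + 2 * u) + 4 * C * ((d + 2 * u) * r + u)) + 2 * p * suc r * C⁻ * (d + 2 * u)
        ≡⟨ lhs t e p C r C⁻ d u ⟩
      d * (t * (e * p + 4 * C * r) + 2 * p * suc r * C⁻) + 2 * u * (t * (e * p + 4 * C * r + 2 * C)) + 4 * u * p * suc r * C⁻
        ≤⟨ +-monoˡ-≤ (4 * u * p * suc r * C⁻) (+-mono-≤ (*-monoʳ-≤ d left) (*-monoʳ-≤ (2 * u) mid)) ⟩
      d * gap C r + 2 * u * gap C r + 4 * u * p * suc r * C⁻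
        ≡⟨ rhs t e p C r C⁻ d u (tri r) ⟩
      4 * e * p * (d + 2 * u) * tri r + p * suc r * (e * (d + 2 * u) + 4 * C⁻ * u) + 2 * C * p * (d + 2 * u) * t ∎
      where
      open ≤-Reasoning
      lhs : ∀ t e p C r D d u →
        t * (e * p * (d + 2 * u) + 4 * C * ((d + 2 * u) * r + u)) + 2 * p * suc r * D * (d + 2 * u)
          ≡ d * (t * (e * p + 4 * C * r) + 2 * p * suc r * D) + 2 * u * (t * (e * p + 4 * C * r + 2 * C)) + 4 * u * p * suc r * D
      lhs = solve-∀
      rhs : ∀ t e p C r D d u f →
        d * (4 * e * p * f + p * suc r * e + 2 * C * p * t) + 2 * u * (4 * e * p * f + p * suc r * e + 2 * C * p * t) + 4 * u * p * suc r * D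
          ≡ 4 * e * p * (d + 2 * u) * f + p * suc r * (e * (d + 2 * u) + 4 * D * u) + 2 * C * p * (d + 2 * u) * t
      rhs = solve-∀

    affine-right : ∀ C {r} M u g d → 2 * g + d ≡ M → g + d ≡ u → DigitCheck C r →
      t * (e * p * M + 4 * C * (M * r + u)) + 2 * p * suc r * C⁺ * M
        ≤ 4 * e * p * M * tri r + p * suc r * (e * M + 4 * C⁺ * u) + 2 * C * p * M * t
    affine-right C {r} _ _ g d refl refl (_ , mid , right) = begin
      t * (e * p * (2 * g + d) + 4 * C * ((2 * g + d) * r + (g + d))) + 2 * p * suc r * C⁺ * (2 * g + d)
        ≡⟨ lhs t e p C r C⁺ g d ⟩
      2 * g * (t * (e * p + 4 * C * r + 2 * C)) + d * (t * (e * p + 4 * C * r + 4 * C)) + 2 * p * suc r * C⁺ * (2 * g + d)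
        ≤⟨ +-monoˡ-≤ (2 * p * suc r * C⁺ * (2 * g + d)) (+-mono-≤ (*-monoʳ-≤ (2 * g) mid) (*-monoʳ-≤ d right)) ⟩
      2 * g * gap C r + d * (gap C r + 2 * p * suc r * C⁺) + 2 * p * suc r * C⁺ * (2 * g + d)
        ≡⟨ rhs t e p C r C⁺ g d (tri r) ⟩
      4 * e * p * (2 * g + d) * tri r + p * suc r * (e * (2 * g + d) + 4 * C⁺ * (g + d)) + 2 * C * p * (2 * g + d) * t ∎
      where
      open ≤-Reasoning
      lhs : ∀ t e p C r D g d →
        t * (e * p * (2 * g + d) + 4 * C * ((2 * g + d) * r + (g + d))) + 2 * p * suc r * D * (2 * g + d)
          ≡ 2 * g * (t * (e * p + 4 * C * r + 2 * C)) + d * (t * (e * p + 4 * C * r + 4 * C)) + 2 * p * suc r * D * (2 * g + d)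
      lhs = solve-∀
      rhs : ∀ t e p C r D g d f →
        2 * g * (4 * e * p * f + p * suc r * e + 2 * C * p * t) + d * (4 * e * p * f + p * suc r * e + 2 * C * p * t + 2 * p * suc r * D) + 2 * p * suc r * D * (2 * g + d)
          ≡ 4 * e * p * (2 * g + d) * f + p * suc r * (e * (2 * g + d) + 4 * D * (g + d)) + 2 * C * p * (2 * g + d) * t
      rhs = solve-∀

  -- The two lines must be carried together: for either outer slope, the step uses the inner line of
  -- slope C⁻ on the left half of the cell and that of slope C⁺ on the right half.
  envelope : SlopeCheck C⁻ → SlopeCheck C⁺ → ∀ j {u} → u ≤ p ^ j → Line C⁻ j u × Line C⁺ j u
  envelope s⁻ s⁺ zero    u≤1 = line-zero C⁻ s⁻ u≤1 , line-zero C⁺ s⁺ u≤1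
  envelope s⁻ s⁺ (suc j) {u} u≤ with digit-split-≤ (pred p) (p ^ j) u (subst (λ q → u ≤ q * p ^ j) (sym (suc-pred p)) u≤)
  ... | (r , u′ , r≤ , u′≤ , refl) = step C⁻ s⁻ , step C⁺ s⁺
    where
    r<p : r < p
    r<p = subst (r <_) (suc-pred p) (s≤s r≤)
    step : ∀ C → SlopeCheck C → Line C (suc j) (p ^ j * r + u′)
    step C (_ , _ , check) with halves u′≤
    ... | inj₁ (d , eq) = line-suc C C⁻ j r<p u′≤ (proj₁ (envelope s⁻ s⁺ j u′≤))
                            (affine-left C (p ^ j) u′ d eq (check r<p))
    ... | inj₂ (g , d , eq , eq′) = line-suc C C⁺ j r<p u′≤ (proj₂ (envelope s⁻ s⁺ j u′≤))
                            (affine-right C (p ^ j) u′ g d eq eq′ (check r<p))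

-- Finite certificates for the lower bound.

-- Because p ^ ϱ = T, scaling arguments by `p` and values by `T` changes nothing. One of the `suc L`
-- factors is matched by `T * c` and `p * y`, so the cut moves by `L` only.
Dominates-unscale : ∀ {p T A X c y} L .{{_ : NonZero p}} .{{_ : NonZero T}} →
  Dominates p T (A * T ^ suc L) (X * p ^ suc L) (T * c) (p * y) → Dominates p T A X c y
Dominates-unscale {p} {T} {A} {X} {c} {y} L dom k m v 1≤v hyp =
  *-cancelʳ-< ((T ^ suc L) ^ v) _ _ (subst₂ _<_ (lhs T A) (rhs T c)
    (dom k (m + L * v) v 1≤v (subst₂ _<_ (sym (lhs p X)) (sym (rhs p y))
      (*-monoˡ-< ((p ^ suc L) ^ v) {{m^n≢0 (p ^ suc L) v {{m^n≢0 p (suc L)}}}} hyp))))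
  where
  open ≡-Reasoning
  lhs : ∀ b x → b ^ k * (x * b ^ suc L) ^ v ≡ b ^ k * x ^ v * (b ^ suc L) ^ v
  lhs b x = trans (cong (b ^ k *_) (^-distribʳ-* x (b ^ suc L) v)) (sym (*-assoc (b ^ k) _ _))
  rhs : ∀ b z → (b * z) ^ v * b ^ (m + L * v) ≡ z ^ v * b ^ m * (b ^ suc L) ^ v
  rhs b z = begin
    (b * z) ^ v * b ^ (m + L * v)              ≡⟨ cong₂ _*_ (^-distribʳ-* b z v) (^-distribˡ-+-* b m (L * v)) ⟩
    b ^ v * z ^ v * (b ^ m * b ^ (L * v))      ≡⟨ cong (λ w → b ^ v * z ^ v * (b ^ m * w)) (^-*-assoc b L v) ⟨
    b ^ v * z ^ v * (b ^ m * (b ^ L) ^ v)      ≡⟨ regroup (b ^ v) (z ^ v) (b ^ m) ((b ^ L) ^ v) ⟩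
    z ^ v * b ^ m * (b ^ v * (b ^ L) ^ v)      ≡⟨ cong (z ^ v * b ^ m *_) (^-distribʳ-* b (b ^ L) v) ⟨
    z ^ v * b ^ m * (b * b ^ L) ^ v            ∎
    where
    regroup : ∀ a b c d → a * b * (c * d) ≡ b * c * (a * d)
    regroup = solve-∀

-- The comparison of F p with (A / E) (n D / X) ^ ϱ on [n , n + 1] / p ^ ℓ.  By
-- convexity of the power function it suffices to compare at the endpoints and the
-- midpoint of the piecewise linear lower envelope of F p; the irrational ϱ is
-- replaced by (Q⁻ + d⁻) / Q⁻ ≤ ϱ to the left of X / D and by
-- (Q⁺ + d⁺) / Q⁺ ≥ ϱ to the right.
module Certificates (p e C⁻ C⁺ A E X D Q⁻ d⁻ Q⁺ d⁺ : ℕ) where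

  open Slopes p e C⁻ C⁺

  private
    t = T p

  -- Cleared form of (A / E) (D y / (2 X p ^ ℓ)) ^ ((Q + d) / Q) ≤ c / (4 e t ^ ℓ). Abscissae are
  -- doubled to make midpoints integers, and `c` is 4 e times the height before the division by t ^
  -- ℓ.
  AtPoint : (Q d ℓ y c : ℕ) → Set
  AtPoint Q d ℓ y c = (4 * e * A * t ^ ℓ) ^ Q * D ^ (Q + d) * y ^ (Q + d) ≤ E ^ Q * (2 * X * p ^ ℓ) ^ (Q + d) * c ^ Q

  Piece : (ℓ y₀ c₀ y₁ c₁ : ℕ) → Set
  Piece ℓ y₀ c₀ y₁ c₁ = 0 < c₀ × 0 < c₁ ×
    ( (D * y₁ ≤ 2 * X * p ^ ℓ × AtPoint Q⁻ d⁻ ℓ y₀ c₀ × AtPoint Q⁻ d⁻ ℓ y₁ c₁)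
    ⊎ (2 * X * p ^ ℓ ≤ D * y₀ × AtPoint Q⁺ d⁺ ℓ y₀ c₀ × AtPoint Q⁺ d⁺ ℓ y₁ c₁))

  mid : ℕ → ℕ → ℕ
  mid f r = 4 * e * f + r * e

  -- The condition 0 < c₀ in `Piece` rules out a truncated subtraction.
  Node : (ℓ n f r : ℕ) → Set
  Node ℓ n f r = Piece ℓ (2 * n) (mid f r ∸ 2 * r * C⁻) (2 * n + 1) (mid f r)
               × Piece ℓ (2 * n + 1) (mid f r) (2 * n + 2) (mid f r + 2 * r * C⁺)

  -- A `Piece` has to lie on one side of X / D. For a table entry with η > 0 this point is interior
  -- to a half of its unit cell, so that cell must be subdivided; it becomes a midpoint at length 1
  -- / p.
  Tree : (n f r : ℕ) → Set
  Tree n f r = Node 0 n f r ⊎ (∀ {s} → s < p → Node 1 (p * n + s) (t * f + r * tri s) (r * suc s))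

  Exponents : Set
  Exponents = NonZero Q⁻ × NonZero Q⁺ × p ^ (Q⁻ + d⁻) ≤ t ^ Q⁻ × t ^ Q⁺ ≤ p ^ (Q⁺ + d⁺)

  Certificate : Set
  Certificate = NonZero A × NonZero e × Exponents × SlopeCheck C⁻ × SlopeCheck C⁺
              × (∀ {i} → i < pred p → Tree (suc i) (tri (suc i)) (suc (suc i)))

  private
    at-point? : ∀ Q d ℓ y c → Dec (AtPoint Q d ℓ y c)
    at-point? Q d ℓ y c = _ ≤? _

    piece? : ∀ ℓ y₀ c₀ y₁ c₁ → Dec (Piece ℓ y₀ c₀ y₁ c₁)
    piece? ℓ y₀ c₀ y₁ c₁ = (0 <? c₀) ×-dec (0 <? c₁) ×-dec
      ( ((D * y₁ ≤? 2 * X * p ^ ℓ) ×-dec at-point? Q⁻ d⁻ ℓ y₀ c₀ ×-dec at-point? Q⁻ d⁻ ℓ y₁ c₁)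
      ⊎-dec ((2 * X * p ^ ℓ ≤? D * y₀) ×-dec at-point? Q⁺ d⁺ ℓ y₀ c₀ ×-dec at-point? Q⁺ d⁺ ℓ y₁ c₁))

    node? : ∀ ℓ n f r → Dec (Node ℓ n f r)
    node? ℓ n f r = piece? ℓ (2 * n) (mid f r ∸ 2 * r * C⁻) (2 * n + 1) (mid f r)
      ×-dec piece? ℓ (2 * n + 1) (mid f r) (2 * n + 2) (mid f r + 2 * r * C⁺)

    tree? : ∀ n f r → Dec (Tree n f r)
    tree? n f r = node? 0 n f r
      ⊎-dec allUpTo? (λ s → node? 1 (p * n + s) (t * f + r * tri s) (r * suc s)) p

  certificate? : Dec Certificate
  certificate? = nonZero? A ×-dec nonZero? e
    ×-dec (nonZero? Q⁻ ×-dec nonZero? Q⁺ ×-dec (_ ≤? _) ×-dec (_ ≤? _))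
    ×-dec slope? C⁻ ×-dec slope? C⁺
    ×-dec allUpTo? (λ i → tree? (suc i) (tri (suc i)) (suc (suc i))) (pred p)

module Descent {p : ℕ} (pp : Prime p) (e C⁻ C⁺ A E X D Q⁻ d⁻ Q⁺ d⁺ : ℕ) where

  open Lucas pp
  open Blocks pp
  open Slopes p e C⁻ C⁺
  open Envelope pp e C⁻ C⁺
  open Certificates p e C⁻ C⁺ A E X D Q⁻ d⁻ Q⁺ d⁺

  private
    t = T p
    instance
      p≢0′ : NonZero p
      p≢0′ = prime⇒nonZero pp
      t≢0′ : NonZero t
      t≢0′ = T≢0

  private
    1<t : 1 < t
    1<t = subst (1 <_) (sym (T≡tri p)) (go 1<p)
      where
      go : ∀ {n} → 1 < n → 1 < tri n
      go {suc n} 1<n = ≤-trans 1<n (m≤n+m (suc n) (tri n))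

    Target : (P Q L n : ℕ) → Set
    Target P Q L n = (D * n) ^ P * (A * t ^ L) ^ Q ≤ (E * F p n) ^ Q * (X * p ^ L) ^ P

    -- By convexity the power curve stays below the chord between the two certified points, and the
    -- last hypothesis puts the chord below `F`. The cancelled factor 2 ^ P (4 e) ^ Q comes from the
    -- scaling in `AtPoint`.
    chord : ∀ Q d ℓ j n {y₀ c₀ y₁ c₁} λ₀ λ₁ .{{_ : NonZero Q}} .{{_ : NonZero e}} →
      0 < c₀ → 0 < c₁ → AtPoint Q d ℓ y₀ c₀ → AtPoint Q d ℓ y₁ c₁ →
      λ₀ + λ₁ ≡ p ^ j → 2 * n ≡ λ₀ * y₀ + λ₁ * y₁ →
      t ^ j * (λ₀ * c₀ + λ₁ * c₁) ≤ 4 * e * p ^ j * F p n →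
      Target (Q + d) Q (ℓ + j) n
    chord Q d ℓ j n {y₀} {c₀} {y₁} {c₁} λ₀ λ₁ 0<c₀ 0<c₁ at₀ at₁ S≡ Y≡ C≤ =
      *-cancelʳ-≤ _ _ (2 ^ P * (4 * e) ^ Q) {{m*n≢0 _ _ {{m^n≢0 2 P}} {{m^n≢0 (4 * e) Q {{m*n≢0 4 e}}}}}} (begin
        (D * n) ^ P * (A * t ^ (ℓ + j)) ^ Q * (2 ^ P * (4 * e) ^ Q)            ≡⟨ lhs ⟩
        U * (2 * n) ^ P * (t ^ j) ^ Q                                          ≡⟨ cong (λ z → U * z ^ P * (t ^ j) ^ Q) Y≡ ⟩
        U * (λ₀ * y₀ + λ₁ * y₁) ^ P * (t ^ j) ^ Q                              ≤⟨ *-monoˡ-≤ ((t ^ j) ^ Q) (convex at₀ at₁) ⟩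
        V * C ^ Q * (λ₀ + λ₁) ^ d * (t ^ j) ^ Q                                ≡⟨ cong (λ z → V * C ^ Q * z ^ d * (t ^ j) ^ Q) S≡ ⟩
        V * C ^ Q * (p ^ j) ^ d * (t ^ j) ^ Q                                  ≡⟨ regroup V (C ^ Q) ((p ^ j) ^ d) ((t ^ j) ^ Q) ⟩
        V * (p ^ j) ^ d * ((t ^ j) ^ Q * C ^ Q)                                ≡⟨ cong (V * (p ^ j) ^ d *_) (^-distribʳ-* (t ^ j) C Q) ⟨
        V * (p ^ j) ^ d * (t ^ j * C) ^ Q                                      ≤⟨ *-monoʳ-≤ (V * (p ^ j) ^ d) (^-monoˡ-≤ Q C≤) ⟩
        V * (p ^ j) ^ d * (4 * e * p ^ j * F p n) ^ Q                          ≡⟨ rhs ⟩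
        (E * F p n) ^ Q * (X * p ^ (ℓ + j)) ^ P * (2 ^ P * (4 * e) ^ Q)        ∎)
      where
      open ≤-Reasoning
      P = Q + d
      C = λ₀ * c₀ + λ₁ * c₁
      U = (4 * e * A * t ^ ℓ) ^ Q * D ^ P
      V = E ^ Q * (2 * X * p ^ ℓ) ^ P
      instance
        c₀≢0 : NonZero c₀
        c₀≢0 = >-nonZero 0<c₀
        c₁≢0 : NonZero c₁
        c₁≢0 = >-nonZero 0<c₁
        S≢0 : NonZero (λ₀ + λ₁)
        S≢0 = subst NonZero (sym S≡) (m^n≢0 p j)
      open Convexity U V Q d y₀ c₀ y₁ c₁ λ₀ λ₁
      regroup : ∀ v c s w → v * c * s * w ≡ v * s * (w * c)
      regroup = solve-∀
      ^3 : ∀ a b c k → (a * b * c) ^ k ≡ a ^ k * b ^ k * c ^ k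
      ^3 a b c k = trans (^-distribʳ-* (a * b) c k) (cong (_* c ^ k) (^-distribʳ-* a b k))
      lhs : (D * n) ^ P * (A * t ^ (ℓ + j)) ^ Q * (2 ^ P * (4 * e) ^ Q) ≡ U * (2 * n) ^ P * (t ^ j) ^ Q
      lhs = begin-equality
        (D * n) ^ P * (A * t ^ (ℓ + j)) ^ Q * (2 ^ P * (4 * e) ^ Q)
          ≡⟨ cong₂ (λ x y → x * y * (2 ^ P * (4 * e) ^ Q)) (^-distribʳ-* D n P)
               (trans (^-distribʳ-* A _ Q) (cong (A ^ Q *_) (trans (cong (_^ Q) (^-distribˡ-+-* t ℓ j)) (^-distribʳ-* (t ^ ℓ) (t ^ j) Q)))) ⟩
        D ^ P * n ^ P * (A ^ Q * ((t ^ ℓ) ^ Q * (t ^ j) ^ Q)) * (2 ^ P * (4 * e) ^ Q)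
          ≡⟨ identity (D ^ P) (n ^ P) (A ^ Q) ((t ^ ℓ) ^ Q) ((t ^ j) ^ Q) (2 ^ P) ((4 * e) ^ Q) ⟩
        (4 * e) ^ Q * A ^ Q * (t ^ ℓ) ^ Q * D ^ P * (2 ^ P * n ^ P) * (t ^ j) ^ Q
          ≡⟨ cong₂ (λ x y → x * D ^ P * y * (t ^ j) ^ Q) (^3 (4 * e) A (t ^ ℓ) Q) (^-distribʳ-* 2 n P) ⟨
        U * (2 * n) ^ P * (t ^ j) ^ Q ∎
        where
        identity : ∀ D n A tl tj two e → D * n * (A * (tl * tj)) * (two * e) ≡ e * A * tl * D * (two * n) * tj
        identity = solve-∀
      rhs : V * (p ^ j) ^ d * (4 * e * p ^ j * F p n) ^ Q ≡ (E * F p n) ^ Q * (X * p ^ (ℓ + j)) ^ P * (2 ^ P * (4 * e) ^ Q)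
      rhs = begin-equality
        E ^ Q * (2 * X * p ^ ℓ) ^ P * (p ^ j) ^ d * (4 * e * p ^ j * F p n) ^ Q
          ≡⟨ cong₂ (λ x y → E ^ Q * x * (p ^ j) ^ d * y) (^3 2 X (p ^ ℓ) P) (^3 (4 * e) (p ^ j) (F p n) Q) ⟩
        E ^ Q * (2 ^ P * X ^ P * (p ^ ℓ) ^ P) * (p ^ j) ^ d * ((4 * e) ^ Q * (p ^ j) ^ Q * F p n ^ Q)
          ≡⟨ identity (E ^ Q) (2 ^ P) (X ^ P) ((p ^ ℓ) ^ P) ((p ^ j) ^ d) ((4 * e) ^ Q) ((p ^ j) ^ Q) (F p n ^ Q) ⟩
        E ^ Q * F p n ^ Q * (X ^ P * ((p ^ ℓ) ^ P * ((p ^ j) ^ Q * (p ^ j) ^ d))) * (2 ^ P * (4 * e) ^ Q)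
          ≡⟨ cong (λ z → E ^ Q * F p n ^ Q * (X ^ P * ((p ^ ℓ) ^ P * z)) * (2 ^ P * (4 * e) ^ Q)) (^-distribˡ-+-* (p ^ j) Q d) ⟨
        E ^ Q * F p n ^ Q * (X ^ P * ((p ^ ℓ) ^ P * (p ^ j) ^ P)) * (2 ^ P * (4 * e) ^ Q)
          ≡⟨ cong₂ (λ x y → x * y * (2 ^ P * (4 * e) ^ Q)) (^-distribʳ-* E (F p n) Q)
               (trans (^-distribʳ-* X _ P) (cong (X ^ P *_) (trans (cong (_^ P) (^-distribˡ-+-* p ℓ j)) (^-distribʳ-* (p ^ ℓ) (p ^ j) P)))) ⟨
        (E * F p n) ^ Q * (X * p ^ (ℓ + j)) ^ P * (2 ^ P * (4 * e) ^ Q) ∎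
        where
        identity : ∀ E two X pl pd e pq f → E * (two * X * pl) * pd * (e * pq * f) ≡ E * f * (X * (pl * (pq * pd))) * (two * e)
        identity = solve-∀

  module Sound .{{_ : NonZero A}} .{{_ : NonZero e}} (exps : Exponents)
               (s⁻ : SlopeCheck C⁻) (s⁺ : SlopeCheck C⁺) where

    private
      Goal : ℕ → ℕ → Set
      Goal L n = Dominates p t (A * t ^ L) (X * p ^ L) (E * F p n) (D * n)

      piece-sound : ∀ ℓ j n {y₀ c₀ y₁ c₁} λ₀ λ₁ → Piece ℓ y₀ c₀ y₁ c₁ → y₀ ≤ y₁ →
        λ₀ + λ₁ ≡ p ^ j → 2 * n ≡ λ₀ * y₀ + λ₁ * y₁ →
        t ^ j * (λ₀ * c₀ + λ₁ * c₁) ≤ 4 * e * p ^ j * F p n → Goal (ℓ + j) n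
      piece-sound ℓ j n {y₀} {c₀} {y₁} {c₁} λ₀ λ₁ (0<c₀ , 0<c₁ , at) y₀≤y₁ S≡ Y≡ C≤ = side at exps
        where
        open ≤-Reasoning
        instance
          At≢0 : NonZero (A * t ^ (ℓ + j))
          At≢0 = m*n≢0 A (t ^ (ℓ + j)) {{it}} {{m^n≢0 t (ℓ + j)}}
        sum-nonZero : ∀ Q d → NonZero Q → NonZero (Q + d)
        sum-nonZero Q d Q≢0 = >-nonZero (≤-trans (>-nonZero⁻¹ Q {{Q≢0}}) (m≤m+n Q d))
        scaled-X : 2 * (X * p ^ (ℓ + j)) ≡ p ^ j * (2 * X * p ^ ℓ)
        scaled-X = trans (cong (λ z → 2 * (X * z)) (^-distribˡ-+-* p ℓ j)) (regroup X (p ^ ℓ) (p ^ j))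
          where
          regroup : ∀ X a b → 2 * (X * (a * b)) ≡ b * (2 * X * a)
          regroup = solve-∀
        front : ∀ a b c → a * (b * c) ≡ b * (a * c)
        front = solve-∀
        factor : ∀ D l l′ y → D * (l * y + l′ * y) ≡ (l + l′) * (D * y)
        factor = solve-∀
        side : _ → Exponents → Goal (ℓ + j) n
        side (inj₁ (left , at₀ , at₁)) (Q≢0 , _ , ≤ϱ , _) =
          Exponent.dominates-left {{it}} {{it}} {{sum-nonZero Q⁻ d⁻ Q≢0}} {{Q≢0}} 1<t
            (chord Q⁻ d⁻ ℓ j n λ₀ λ₁ {{Q≢0}} 0<c₀ 0<c₁ at₀ at₁ S≡ Y≡ C≤) ≤ϱ
            (*-cancelˡ-≤ 2 (begin
              2 * (D * n)                     ≡⟨ front 2 D n ⟩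
              D * (2 * n)                     ≡⟨ cong (D *_) Y≡ ⟩
              D * (λ₀ * y₀ + λ₁ * y₁)         ≤⟨ *-monoʳ-≤ D (+-monoˡ-≤ (λ₁ * y₁) (*-monoʳ-≤ λ₀ y₀≤y₁)) ⟩
              D * (λ₀ * y₁ + λ₁ * y₁)         ≡⟨ factor D λ₀ λ₁ y₁ ⟩
              (λ₀ + λ₁) * (D * y₁)            ≡⟨ cong (_* (D * y₁)) S≡ ⟩
              p ^ j * (D * y₁)                ≤⟨ *-monoʳ-≤ (p ^ j) left ⟩
              p ^ j * (2 * X * p ^ ℓ)         ≡⟨ scaled-X ⟨
              2 * (X * p ^ (ℓ + j))           ∎))
        side (inj₂ (right , at₀ , at₁)) (_ , Q≢0 , _ , ϱ≤) =
          Exponent.dominates-right {{it}} {{it}} {{sum-nonZero Q⁺ d⁺ Q≢0}} {{Q≢0}} 1<t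
            (chord Q⁺ d⁺ ℓ j n λ₀ λ₁ {{Q≢0}} 0<c₀ 0<c₁ at₀ at₁ S≡ Y≡ C≤) ϱ≤
            (*-cancelˡ-≤ 2 (begin
              2 * (X * p ^ (ℓ + j))           ≡⟨ scaled-X ⟩
              p ^ j * (2 * X * p ^ ℓ)         ≤⟨ *-monoʳ-≤ (p ^ j) right ⟩
              p ^ j * (D * y₀)                ≡⟨ cong (_* (D * y₀)) S≡ ⟨
              (λ₀ + λ₁) * (D * y₀)            ≡⟨ factor D λ₀ λ₁ y₀ ⟨
              D * (λ₀ * y₀ + λ₁ * y₀)         ≤⟨ *-monoʳ-≤ D (+-monoʳ-≤ (λ₀ * y₀) (*-monoʳ-≤ λ₁ y₀≤y₁)) ⟩
              D * (λ₀ * y₀ + λ₁ * y₁)         ≡⟨ cong (D *_) Y≡ ⟨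
              D * (2 * n)                     ≡⟨ front 2 D n ⟨
              2 * (D * n)                     ∎))

      -- w / (4 e p ^ j) is the value at n + u / p ^ j of the lower line of slope C.
      below-line : ∀ C j n {u} w → u ≤ p ^ j → Line C j u →
        w + 2 * row p n * C * p ^ j ≡ mid (F p n) (row p n) * p ^ j + 4 * row p n * C * u →
        t ^ j * w ≤ 4 * e * p ^ j * F p (p ^ j * n + u)
      below-line C j n {u} w u≤ line eq = +-cancelʳ-≤ (t ^ j * (2 * r * C * M)) _ _ (begin
        t ^ j * w + t ^ j * (2 * r * C * M)             ≡⟨ *-distribˡ-+ (t ^ j) w _ ⟨
        t ^ j * (w + 2 * r * C * M)                     ≡⟨ cong (t ^ j *_) eq ⟩
        t ^ j * (mid f r * M + 4 * r * C * u)           ≡⟨ lhs (t ^ j) e f r M C u ⟩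
        4 * e * M * (t ^ j * f) + r * (t ^ j * (e * M + 4 * C * u))
          ≤⟨ +-monoʳ-≤ (4 * e * M * (t ^ j * f)) (*-monoʳ-≤ r line) ⟩
        4 * e * M * (t ^ j * f) + r * (4 * e * M * F p u + 2 * C * M * t ^ j)
          ≡⟨ rhs (t ^ j) e f r M C (F p u) ⟩
        4 * e * M * (t ^ j * f + r * F p u) + t ^ j * (2 * r * C * M)
          ≡⟨ cong (λ z → 4 * e * M * z + t ^ j * (2 * r * C * M)) (F-block n j u≤) ⟨
        4 * e * M * F p (M * n + u) + t ^ j * (2 * r * C * M) ∎)
        where
        open ≤-Reasoning
        M = p ^ j
        f = F p n
        r = row p n
        lhs : ∀ tj e f r M C u → tj * ((4 * e * f + r * e) * M + 4 * r * C * u) ≡ 4 * e * M * (tj * f) + r * (tj * (e * M + 4 * C * u))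
        lhs = solve-∀
        rhs : ∀ tj e f r M C g → 4 * e * M * (tj * f) + r * (4 * e * M * g + 2 * C * M * tj) ≡ 4 * e * M * (tj * f + r * g) + tj * (2 * r * C * M)
        rhs = solve-∀

      node-sound : ∀ ℓ n → Node ℓ n (F p n) (row p n) → ∀ j {u} → u ≤ p ^ j → Goal (ℓ + j) (p ^ j * n + u)
      node-sound ℓ n (left , right) j {u} u≤ with halves u≤ | envelope s⁻ s⁺ j u≤
      ... | inj₁ (d , S≡) | (line , _) =
        piece-sound ℓ j (p ^ j * n + u) d (2 * u) left (m≤m+n (2 * n) 1) S≡
          (trans (cong (λ M → 2 * (M * n + u)) (sym S≡)) (point d u n))
          (below-line C⁻ j n _ u≤ line
            (trans (cong (λ M → d * (c ∸ δ) + 2 * u * c + δ * M) (sym S≡))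
              (trans (value d u (c ∸ δ) c δ (m∸n+n≡m (<⇒≤ (m<n∸o⇒o<n left))))
                (cong₂ (λ M w → c * M + w) S≡ (regroup r C⁻ u)))))
        where
        r = row p n
        c = mid (F p n) r
        δ = 2 * r * C⁻
        m<n∸o⇒o<n : _ → δ < c
        m<n∸o⇒o<n (0<c₀ , _) = m∸n≢0⇒n<m (n>0⇒n≢0 0<c₀)
        point : ∀ d u n → 2 * ((d + 2 * u) * n + u) ≡ d * (2 * n) + 2 * u * (2 * n + 1)
        point = solve-∀
        regroup : ∀ r C u → 2 * r * C * (2 * u) ≡ 4 * r * C * u
        regroup = solve-∀
        value : ∀ d u c₀ c δ → c₀ + δ ≡ c → d * c₀ + 2 * u * c + δ * (d + 2 * u) ≡ c * (d + 2 * u) + δ * (2 * u)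
        value d u c₀ _ δ refl = identity d u c₀ δ
          where
          identity : ∀ d u c₀ δ → d * c₀ + 2 * u * (c₀ + δ) + δ * (d + 2 * u) ≡ (c₀ + δ) * (d + 2 * u) + δ * (2 * u)
          identity = solve-∀
      ... | inj₂ (g , d , S≡ , u≡) | (_ , line) =
        piece-sound ℓ j (p ^ j * n + u) (2 * g) d right (+-monoʳ-≤ (2 * n) (s≤s z≤n)) S≡
          (trans (cong₂ (λ M u → 2 * (M * n + u)) (sym S≡) (sym u≡)) (point g d n))
          (below-line C⁺ j n _ u≤ line
            (trans (cong (λ M → 2 * g * c + d * (c + 2 * r * C⁺) + 2 * r * C⁺ * M) (sym S≡))
              (trans (value g d c r C⁺) (cong₂ (λ M u → c * M + 4 * r * C⁺ * u) S≡ u≡))))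
        where
        r = row p n
        c = mid (F p n) r
        point : ∀ g d n → 2 * ((2 * g + d) * n + (g + d)) ≡ 2 * g * (2 * n + 1) + d * (2 * n + 2)
        point = solve-∀
        value : ∀ g d c r C → 2 * g * c + d * (c + 2 * r * C) + 2 * r * C * (2 * g + d) ≡ c * (2 * g + d) + 4 * r * C * (g + d)
        value = solve-∀

      tree-sound : ∀ n → Tree n (F p n) (row p n) → ∀ j {u} → u < p ^ suc j → Goal (suc j) (p ^ suc j * n + u)
      tree-sound n (inj₁ node) j u< = node-sound 0 n node (suc j) (<⇒≤ u<)
      tree-sound n (inj₂ nodes) j {u} u< with digit-split u (p ^ j) {{m^n≢0 p j}}
      ... | (s , u′ , u′< , refl) = subst (Goal (suc j)) (sym (regroup p (p ^ j) n s u′))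
        (node-sound 1 (p * n + s)
          (subst₂ (Node 1 (p * n + s)) (sym (F-digit n (<⇒≤ s<p))) (sym (row-digit n s<p)) (nodes s<p))
          j (<⇒≤ u′<))
        where
        s<p : s < p
        s<p = *-cancelˡ-< (p ^ j) s p (≤-<-trans (m≤m+n _ u′) (subst (p ^ j * s + u′ <_) (*-comm p (p ^ j)) u<))
        regroup : ∀ p M n s u → p * M * n + (M * s + u) ≡ M * (p * n + s) + u
        regroup = solve-∀

    lower-bound : (∀ {i} → i < pred p → Tree (suc i) (tri (suc i)) (suc (suc i))) →
                  ∀ n → 1 ≤ n → Dominates p t A X (E * F p n) (D * n)
    lower-bound trees n 1≤n with leading-digit p 1<p n 1≤n
    ... | (j , zero , u , () , _)
    -- The bound is proved for `p * m` and then unscaled: this appends a digit 0, so that even a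
    -- one-digit number has the second digit that a subdivided tree asks for.
    ... | (j , suc i , u , _ , i<p , u< , refl) = Dominates-unscale j
      (subst₂ (Dominates p t (A * t ^ suc j) (X * p ^ suc j)) c≡ y≡
        (subst (Goal (suc j)) (sym (regroup p (p ^ j) (suc i) u))
          (tree-sound (suc i) tree j (*-monoʳ-< p u<))))
      where
      m = p ^ j * suc i + u
      tree : Tree (suc i) (F p (suc i)) (row p (suc i))
      tree = subst₂ (Tree (suc i)) (sym (F-small (<⇒≤ i<p))) (sym (row-small i<p))
        (trees (s≤s⁻¹ (subst (suc i <_) (sym (suc-pred p)) i<p)))
      front : ∀ a b c → a * (b * c) ≡ b * (a * c)
      front = solve-∀
      regroup : ∀ p M i u → p * (M * i + u) ≡ p * M * i + p * u
      regroup = solve-∀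
      c≡ : E * F p (p * m) ≡ t * (E * F p m)
      c≡ = trans (cong (E *_) (F-* m)) (front E t (F p m))
      y≡ : D * (p * m) ≡ p * (D * m)
      y≡ = front D p m

  certified : Certificate → ∀ n → 1 ≤ n → Dominates p t A X (E * F p n) (D * n)
  certified (A≢0 , e≢0 , exps , s⁻ , s⁺ , trees) = Sound.lower-bound {{A≢0}} {{e≢0}} exps s⁻ s⁺ trees

-- From natural numbers to the rational cuts.

ℕ→ℚ-mkℚ : ∀ n → ℕ→ℚ n ≡ mkℚ (ℤ.+ n) 0 (coprime-sym (1-coprimeTo n))
ℕ→ℚ-mkℚ n = ℚ.normalize-coprime (coprime-sym (1-coprimeTo n))

ℕ→ℚ-* : ∀ m n → ℕ→ℚ (m * n) ≡ ℕ→ℚ m ℚ.* ℕ→ℚ n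
ℕ→ℚ-* m n = sym (trans (cong₂ ℚ._*_ (ℕ→ℚ-mkℚ m) (ℕ→ℚ-mkℚ n)) (cong (ℚ._/ 1) (sym (ℤ.pos-* m n))))

ℕ→ℚ-^ : ∀ n k → ℕ→ℚ (n ^ k) ≡ ℕ→ℚ n ^ℚ k
ℕ→ℚ-^ n zero    = refl
ℕ→ℚ-^ n (suc k) = trans (ℕ→ℚ-* n (n ^ k)) (cong (ℕ→ℚ n ℚ.*_) (ℕ→ℚ-^ n k))

ℕ→ℚ-mono-< : ∀ {m n} → m < n → ℕ→ℚ m ℚ.< ℕ→ℚ n
ℕ→ℚ-mono-< {m} {n} m<n rewrite ℕ→ℚ-mkℚ m | ℕ→ℚ-mkℚ n =
  ℚ.*<* (ℤ.*-monoʳ-<-pos (ℤ.+ 1) (ℤ.+<+ m<n))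

ℕ→ℚ-mono-≤ : ∀ {m n} → m ≤ n → ℕ→ℚ m ℚ.≤ ℕ→ℚ n
ℕ→ℚ-mono-≤ m≤n with m≤n⇒m<n∨m≡n m≤n
... | inj₁ m<n  = ℚ.<⇒≤ (ℕ→ℚ-mono-< m<n)
... | inj₂ refl = ℚ.≤-refl

ℕ→ℚ-cancel-< : ∀ {m n} → ℕ→ℚ m ℚ.< ℕ→ℚ n → m < n
ℕ→ℚ-cancel-< lt = ≰⇒> λ n≤m → ℚ.<-irrefl refl (ℚ.<-≤-trans lt (ℕ→ℚ-mono-≤ n≤m))

ℕ→ℚ-pos : ∀ n .{{_ : NonZero n}} → ℚ.Positive (ℕ→ℚ n)
ℕ→ℚ-pos n = ℚ.normalize-pos n 1

^ℚ-distrib-* : ∀ x y k → (x ℚ.* y) ^ℚ k ≡ (x ^ℚ k) ℚ.* (y ^ℚ k)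
^ℚ-distrib-* x y zero    = refl
^ℚ-distrib-* x y (suc k) = trans (cong (x ℚ.* y ℚ.*_) (^ℚ-distrib-* x y k))
  (solve 4 (λ a b c d → a :* b :* (c :* d) := a :* c :* (b :* d)) refl x y (x ^ℚ k) (y ^ℚ k))
  where open +-*-Solver

1^ℚ : ∀ k → ℚ.1ℚ ^ℚ k ≡ ℚ.1ℚ
1^ℚ zero    = refl
1^ℚ (suc k) = trans (ℚ.*-identityˡ _) (1^ℚ k)

clear-denominator : ∀ {x X D} → x ℚ.* ℕ→ℚ D ≡ ℕ→ℚ X → ∀ k v b →
  (ℕ→ℚ b ^ℚ k) ℚ.* (x ^ℚ v) ℚ.* ℕ→ℚ (D ^ v) ≡ ℕ→ℚ (b ^ k * X ^ v)
clear-denominator {x} {X} {D} eq k v b = begin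
  (ℕ→ℚ b ^ℚ k) ℚ.* (x ^ℚ v) ℚ.* ℕ→ℚ (D ^ v)          ≡⟨ cong₂ (λ y z → y ℚ.* (x ^ℚ v) ℚ.* z) (sym (ℕ→ℚ-^ b k)) (ℕ→ℚ-^ D v) ⟩
  ℕ→ℚ (b ^ k) ℚ.* (x ^ℚ v) ℚ.* (ℕ→ℚ D ^ℚ v)          ≡⟨ ℚ.*-assoc (ℕ→ℚ (b ^ k)) _ _ ⟩
  ℕ→ℚ (b ^ k) ℚ.* ((x ^ℚ v) ℚ.* (ℕ→ℚ D ^ℚ v))        ≡⟨ cong (ℕ→ℚ (b ^ k) ℚ.*_) (trans (sym (^ℚ-distrib-* x (ℕ→ℚ D) v)) (trans (cong (_^ℚ v) eq) (sym (ℕ→ℚ-^ X v)))) ⟩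
  ℕ→ℚ (b ^ k) ℚ.* ℕ→ℚ (X ^ v)                        ≡⟨ ℕ→ℚ-* (b ^ k) (X ^ v) ⟨
  ℕ→ℚ (b ^ k * X ^ v)                                ∎
  where open ≡-Reasoning

scale-denominator : ∀ n D m v b →
  (ℕ→ℚ n ^ℚ v) ℚ.* (ℕ→ℚ b ^ℚ m) ℚ.* ℕ→ℚ (D ^ v) ≡ ℕ→ℚ ((D * n) ^ v * b ^ m)
scale-denominator n D m v b = begin
  (ℕ→ℚ n ^ℚ v) ℚ.* (ℕ→ℚ b ^ℚ m) ℚ.* ℕ→ℚ (D ^ v)      ≡⟨ cong₂ (λ y z → y ℚ.* z ℚ.* ℕ→ℚ (D ^ v)) (sym (ℕ→ℚ-^ n v)) (sym (ℕ→ℚ-^ b m)) ⟩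
  ℕ→ℚ (n ^ v) ℚ.* ℕ→ℚ (b ^ m) ℚ.* ℕ→ℚ (D ^ v)        ≡⟨ cong (ℚ._* ℕ→ℚ (D ^ v)) (ℕ→ℚ-* (n ^ v) (b ^ m)) ⟨
  ℕ→ℚ (n ^ v * b ^ m) ℚ.* ℕ→ℚ (D ^ v)                ≡⟨ ℕ→ℚ-* (n ^ v * b ^ m) (D ^ v) ⟨
  ℕ→ℚ (n ^ v * b ^ m * D ^ v)                        ≡⟨ cong ℕ→ℚ (trans (regroup (n ^ v) (b ^ m) (D ^ v)) (cong (_* b ^ m) (sym (^-distribʳ-* D n v)))) ⟩
  ℕ→ℚ ((D * n) ^ v * b ^ m)                          ∎
  where
  open ≡-Reasoning
  regroup : ∀ a b c → a * b * c ≡ c * a * b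
  regroup = solve-∀

Le-from-ℕ : ∀ {p a x A E X D} n .{{_ : NonZero E}} .{{_ : NonZero D}} →
  a ℚ.* ℕ→ℚ E ≡ ℕ→ℚ A → x ℚ.* ℕ→ℚ D ≡ ℕ→ℚ X →
  Dominates p (T p) A X (E * F p n) (D * n) → Le p (a , x) (ratio p n)
Le-from-ℕ {p} {a} {x} {A} {E} {X} {D} n a≡ x≡ dom k m v 1≤v hyp =
  ℚ.*-cancelʳ-<-nonNeg (ℕ→ℚ (E ^ v)) {{ℚ.pos⇒nonNeg (ℕ→ℚ (E ^ v)) {{ℕ→ℚ-pos (E ^ v) {{m^n≢0 E v}}}}}}
    (subst₂ ℚ._<_ (sym (clear-denominator a≡ k v (T p))) (sym (scale-denominator (F p n) E m v (T p)))
      (ℕ→ℚ-mono-< (dom k m v 1≤v (ℕ→ℚ-cancel-<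
        (subst₂ ℚ._<_ (clear-denominator x≡ k v p) (scale-denominator n D m v p)
          (ℚ.*-monoˡ-<-pos (ℕ→ℚ (D ^ v)) {{ℕ→ℚ-pos (D ^ v) {{m^n≢0 D v}}}} hyp))))))

-- For every cut with p ^ ((m - k) / v) < X / D there is a point n / p ^ L that still lies above it
-- and whose value F(n) / T ^ L is at most A / E. Since p ^ ϱ = T, such a point has the same
-- monomial as `ratio p n`; a witness (k , m , v) for the limit then becomes (k , m + L v , v).
Approximable : (p A E X D : ℕ) → Set
Approximable p A E X D = ∀ k m v → 1 ≤ v → p ^ m * D ^ v < p ^ k * X ^ v →
  ∃[ n ] ∃[ L ] (p ^ (m + L * v) < p ^ k * n ^ v × E * F p n ≤ A * T p ^ L)

inf-from-ℕ : ∀ {p a x A E X D} .{{_ : NonZero E}} .{{_ : NonZero D}} .{{_ : NonZero (T p)}} →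
  a ℚ.* ℕ→ℚ E ≡ ℕ→ℚ A → x ℚ.* ℕ→ℚ D ≡ ℕ→ℚ X → Approximable p A E X D →
  ∀ q → Lt p (a , x) (const q) → ∃[ n ] (1 ≤ n × Lt p (ratio p n) (const q))
inf-from-ℕ {p} {a} {x} {A} {E} {X} {D} a≡ x≡ approx q (k , m , v , 1≤v , base , coef) =
  attained (approx k m v 1≤v (ℕ→ℚ-cancel-< (subst₂ ℚ._<_
    (trans (cong (λ z → z ℚ.* (ℕ→ℚ p ^ℚ m) ℚ.* ℕ→ℚ (D ^ v)) (1^ℚ v))
      (trans (cong (ℚ._* ℕ→ℚ (D ^ v)) (trans (ℚ.*-identityˡ _) (sym (ℕ→ℚ-^ p m)))) (sym (ℕ→ℚ-* (p ^ m) (D ^ v)))))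
    (clear-denominator x≡ k v p)
    (ℚ.*-monoˡ-<-pos (ℕ→ℚ (D ^ v)) {{ℕ→ℚ-pos (D ^ v) {{m^n≢0 D v}}}} base))))
  where
  attained : ∃[ n ] ∃[ L ] (p ^ (m + L * v) < p ^ k * n ^ v × E * F p n ≤ A * T p ^ L) →
    ∃[ n ] (1 ≤ n × Lt p (ratio p n) (const q))
  attained (n , L , lt , le) = n , 1≤n n v 1≤v lt , k , m + L * v , v , 1≤v , base′ , coef′
    where
    1≤n : ∀ n v → 1 ≤ v → p ^ (m + L * v) < p ^ k * n ^ v → 1 ≤ n
    1≤n zero    (suc v) _ lt′ = contradiction (subst (p ^ (m + L * suc v) <_) (*-zeroʳ (p ^ k)) lt′) n≮0
    1≤n (suc n) v       _ _   = z<s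
    base′ : (ℚ.1ℚ ^ℚ v) ℚ.* (ℕ→ℚ p ^ℚ (m + L * v)) ℚ.< (ℕ→ℚ p ^ℚ k) ℚ.* (ℕ→ℚ n ^ℚ v)
    base′ = subst₂ ℚ._<_
      (trans (ℕ→ℚ-^ p (m + L * v)) (trans (sym (ℚ.*-identityˡ _)) (cong (ℚ._* (ℕ→ℚ p ^ℚ (m + L * v))) (sym (1^ℚ v)))))
      (trans (ℕ→ℚ-* (p ^ k) (n ^ v)) (cong₂ ℚ._*_ (ℕ→ℚ-^ p k) (ℕ→ℚ-^ n v)))
      (ℕ→ℚ-mono-< lt)
    t = T p
    w = ℕ→ℚ ((t ^ L) ^ v)
    E^ = ℕ→ℚ (E ^ v)
    instance
      w-pos : ℚ.Positive w
      w-pos = ℕ→ℚ-pos ((t ^ L) ^ v) {{m^n≢0 (t ^ L) v {{m^n≢0 t L}}}}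
      E-pos : ℚ.Positive E^
      E-pos = ℕ→ℚ-pos (E ^ v) {{m^n≢0 E v}}
    ℕ-bound : t ^ k * (E * F p n) ^ v ≤ t ^ k * A ^ v * (t ^ L) ^ v
    ℕ-bound = ≤-trans (*-monoʳ-≤ (t ^ k) (^-monoˡ-≤ v le))
      (≤-reflexive (trans (cong (t ^ k *_) (^-distribʳ-* A (t ^ L) v)) (sym (*-assoc (t ^ k) _ _))))
    coef′ : (ℕ→ℚ t ^ℚ k) ℚ.* (ℕ→ℚ (F p n) ^ℚ v) ℚ.< (q ^ℚ v) ℚ.* (ℕ→ℚ t ^ℚ (m + L * v))
    coef′ = ℚ.*-cancelʳ-<-nonNeg E^ {{ℚ.pos⇒nonNeg E^}} (begin-strict
      (ℕ→ℚ t ^ℚ k) ℚ.* (ℕ→ℚ (F p n) ^ℚ v) ℚ.* E^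
        ≡⟨ trans (cong (ℚ._* E^) (ℚ.*-comm (ℕ→ℚ t ^ℚ k) (ℕ→ℚ (F p n) ^ℚ v))) (scale-denominator (F p n) E k v t) ⟩
      ℕ→ℚ ((E * F p n) ^ v * t ^ k)                      ≡⟨ cong ℕ→ℚ (*-comm ((E * F p n) ^ v) (t ^ k)) ⟩
      ℕ→ℚ (t ^ k * (E * F p n) ^ v)                      ≤⟨ ℕ→ℚ-mono-≤ ℕ-bound ⟩
      ℕ→ℚ (t ^ k * A ^ v * (t ^ L) ^ v)                  ≡⟨ ℕ→ℚ-* (t ^ k * A ^ v) ((t ^ L) ^ v) ⟩
      ℕ→ℚ (t ^ k * A ^ v) ℚ.* w                          ≡⟨ cong (ℚ._* w) (clear-denominator a≡ k v t) ⟨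
      (ℕ→ℚ t ^ℚ k) ℚ.* (a ^ℚ v) ℚ.* E^ ℚ.* w             <⟨ ℚ.*-monoˡ-<-pos w (ℚ.*-monoˡ-<-pos E^ coef) ⟩
      (q ^ℚ v) ℚ.* (ℕ→ℚ t ^ℚ m) ℚ.* E^ ℚ.* w             ≡⟨ solve 4 (λ a b c d → a :* b :* c :* d := a :* (b :* d) :* c) refl (q ^ℚ v) (ℕ→ℚ t ^ℚ m) E^ w ⟩
      (q ^ℚ v) ℚ.* ((ℕ→ℚ t ^ℚ m) ℚ.* w) ℚ.* E^           ≡⟨ cong (λ z → (q ^ℚ v) ℚ.* z ℚ.* E^) power ⟩
      (q ^ℚ v) ℚ.* (ℕ→ℚ t ^ℚ (m + L * v)) ℚ.* E^         ∎)
      where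
      open ℚ.≤-Reasoning
      open +-*-Solver
      power : (ℕ→ℚ t ^ℚ m) ℚ.* w ≡ ℕ→ℚ t ^ℚ (m + L * v)
      power = trans (cong (ℚ._* w) (sym (ℕ→ℚ-^ t m))) (trans (sym (ℕ→ℚ-* (t ^ m) ((t ^ L) ^ v)))
        (trans (cong ℕ→ℚ (trans (cong (t ^ m *_) (^-*-assoc t L v)) (sym (^-distribˡ-+-* t m (L * v))))) (ℕ→ℚ-^ t (m + L * v))))

-- Approach to the infimum.

-- The mean value bound for consecutive powers. At v = 0 the truncated `pred v` is harmless, being
-- multiplied by 0.
^-decrement : ∀ s v → suc s ^ v ≤ s ^ v + v * suc s ^ pred v
^-decrement s zero          = s≤s z≤n
^-decrement s (suc zero)    = ≤-reflexive (identity s)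
  where
  identity : ∀ s → suc s * 1 ≡ s * 1 + 1 * 1
  identity = solve-∀
^-decrement s (suc v@(suc v′)) = begin
  suc s * suc s ^ v                                   ≡⟨⟩
  suc s ^ v + s * suc s ^ v                           ≤⟨ +-monoʳ-≤ (suc s ^ v) (*-monoʳ-≤ s (^-decrement s v)) ⟩
  suc s ^ v + s * (s ^ v + v * suc s ^ v′)            ≤⟨ m≤m+n _ (v * suc s ^ v′) ⟩
  suc s ^ v + s * (s ^ v + v * suc s ^ v′) + v * suc s ^ v′ ≡⟨ identity s v (s ^ v) (suc s ^ v′) ⟩
  s * s ^ v + suc v * suc s ^ v                       ∎
  where
  open ≤-Reasoning
  identity : ∀ s v a b → suc s * b + s * (a + v * b) + v * b ≡ s * a + suc v * (suc s * b)
  identity = solve-∀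

-- The points n₀ p ^ i + (p ^ i - 1) / 2 approach (n₀ + 1/2) p ^ i, and 4 F + row is
-- multiplied by T p when the middle digit h is appended.
module Approximation {p : ℕ} (pp : Prime p) (h : ℕ) (p≡ : p ≡ 2 * h + 1) (n₀ : ℕ) where

  open Lucas pp
  open Blocks pp

  private
    instance
      p≢0′ : NonZero p
      p≢0′ = prime⇒nonZero pp

    ν : ℕ → ℕ
    ν zero    = n₀
    ν (suc i) = p * ν i + h

    h<p : h < p
    h<p = subst (h <_) (sym p≡) (subst (_≤ 2 * h + 1) (+-comm h 1) (+-monoˡ-≤ 1 (m≤n*m h 2)))

    T≡ : T p ≡ p * suc h
    T≡ = *-cancelˡ-≡ (T p) (p * suc h) 2 (begin
      2 * T p              ≡⟨ cong (2 *_) (T≡tri p) ⟩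
      2 * tri p            ≡⟨ 2*tri p ⟩
      p * suc p            ≡⟨ cong (λ z → z * suc z) p≡ ⟩
      (2 * h + 1) * suc (2 * h + 1)   ≡⟨ identity h ⟩
      2 * ((2 * h + 1) * suc h)       ≡⟨ cong (λ z → 2 * (z * suc h)) p≡ ⟨
      2 * (p * suc h)      ∎)
      where
      open ≡-Reasoning
      identity : ∀ h → (2 * h + 1) * suc (2 * h + 1) ≡ 2 * ((2 * h + 1) * suc h)
      identity = solve-∀

    2ν+1 : ∀ i → suc (2 * ν i) ≡ suc (2 * n₀) * p ^ i
    2ν+1 zero    = sym (*-identityʳ _)
    2ν+1 (suc i) = begin
      suc (2 * (p * ν i + h))              ≡⟨ left p (ν i) h ⟩
      p * (2 * ν i) + (2 * h + 1)          ≡⟨ cong (p * (2 * ν i) +_) p≡ ⟨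
      p * (2 * ν i) + p                    ≡⟨ trans (+-comm _ p) (sym (*-suc p (2 * ν i))) ⟩
      p * suc (2 * ν i)                    ≡⟨ cong (p *_) (2ν+1 i) ⟩
      p * (suc (2 * n₀) * p ^ i)           ≡⟨ front p (suc (2 * n₀)) (p ^ i) ⟩
      suc (2 * n₀) * (p * p ^ i)           ∎
      where
      open ≡-Reasoning
      left : ∀ p n h → suc (2 * (p * n + h)) ≡ p * (2 * n) + (2 * h + 1)
      left = solve-∀
      front : ∀ a b c → a * (b * c) ≡ b * (a * c)
      front = solve-∀

    4F+row : ∀ i → 4 * F p (ν i) + row p (ν i) ≡ (4 * F p n₀ + row p n₀) * T p ^ i
    4F+row zero    = sym (*-identityʳ _)
    4F+row (suc i) = begin
      4 * F p (p * ν i + h) + row p (p * ν i + h)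
        ≡⟨ cong₂ (λ x y → 4 * x + y) (F-digit (ν i) (<⇒≤ h<p)) (row-digit (ν i) h<p) ⟩
      4 * (T p * F p (ν i) + row p (ν i) * tri h) + row p (ν i) * suc h
        ≡⟨ collect (T p) (F p (ν i)) (row p (ν i)) (tri h) h ⟩
      T p * (4 * F p (ν i)) + row p (ν i) * (2 * (2 * tri h) + suc h)
        ≡⟨ cong (λ z → T p * (4 * F p (ν i)) + row p (ν i) * z) middle ⟩
      T p * (4 * F p (ν i)) + row p (ν i) * T p
        ≡⟨ factor (T p) (4 * F p (ν i)) (row p (ν i)) ⟩
      T p * (4 * F p (ν i) + row p (ν i))
        ≡⟨ cong (T p *_) (4F+row i) ⟩
      T p * ((4 * F p n₀ + row p n₀) * T p ^ i)
        ≡⟨ front (T p) (4 * F p n₀ + row p n₀) (T p ^ i) ⟩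
      (4 * F p n₀ + row p n₀) * (T p * T p ^ i) ∎
      where
      open ≡-Reasoning
      collect : ∀ t f r g h → 4 * (t * f + r * g) + r * suc h ≡ t * (4 * f) + r * (2 * (2 * g) + suc h)
      collect = solve-∀
      factor : ∀ t f r → t * f + r * t ≡ t * (f + r)
      factor = solve-∀
      front : ∀ a b c → a * (b * c) ≡ b * (a * c)
      front = solve-∀
      identity : ∀ h → 2 * (h * suc h) + suc h ≡ (2 * h + 1) * suc h
      identity = solve-∀
      -- Four times T/4 = tri h + (h + 1)/4: the height 1/4 is fixed by the digit `h`.
      middle : 2 * (2 * tri h) + suc h ≡ T p
      middle = trans (cong (λ z → 2 * z + suc h) (2*tri h))
        (trans (identity h) (sym (trans T≡ (cong (_* suc h) p≡))))

  -- Dropping the nonnegative `row` from `4F+row` bounds the values at once. The positions increase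
  -- to X / D from below, so only the strict inequality for the base calls for a large `i`.
  approximable : Approximable p (4 * F p n₀ + row p n₀) (4 * T p) (suc (2 * n₀)) (2 * p)
  approximable k m v 1≤v lt = ν i , suc i , base , coef
    where
    open ≤-Reasoning
    X = suc (2 * n₀)
    -- Replacing `suc s` = X K by `s` costs at most p ^ k v (X K) ^ (v - 1) = i K ^ (v - 1). This is
    -- less than K ^ v because i < p ^ i = K, and K ^ v is what the strictness of `lt` between
    -- integers provides.
    i = p ^ k * (v * X ^ pred v)
    K = p ^ i
    s = 2 * ν i
    K^v : K * K ^ pred v ≡ K ^ v
    K^v = cong (K ^_) (suc-pred v {{>-nonZero 1≤v}})
    slack : p ^ k * (v * suc s ^ pred v) < K ^ v
    slack = begin-strict
      p ^ k * (v * suc s ^ pred v)                  ≡⟨ cong (λ z → p ^ k * (v * z ^ pred v)) (2ν+1 i) ⟩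
      p ^ k * (v * (X * K) ^ pred v)                ≡⟨ cong (λ z → p ^ k * (v * z)) (^-distribʳ-* X K (pred v)) ⟩
      p ^ k * (v * (X ^ pred v * K ^ pred v))       ≡⟨ regroup (p ^ k) v (X ^ pred v) (K ^ pred v) ⟩
      i * K ^ pred v                                <⟨ *-monoˡ-< (K ^ pred v) {{m^n≢0 K (pred v) {{m^n≢0 p i}}}} (n<m^n 1<p i) ⟩
      K * K ^ pred v                                ≡⟨ K^v ⟩
      K ^ v                                         ∎
      where
      regroup : ∀ a b c d → a * (b * (c * d)) ≡ a * (b * c) * d
      regroup = solve-∀
    doubled : p ^ m * (2 * p) ^ v * K ^ v < p ^ k * s ^ v
    doubled = +-cancelʳ-< (K ^ v) _ _ (begin-strict
      p ^ m * (2 * p) ^ v * K ^ v + K ^ v           ≡⟨ +-comm _ (K ^ v) ⟩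
      suc (p ^ m * (2 * p) ^ v) * K ^ v             ≤⟨ *-monoˡ-≤ (K ^ v) lt ⟩
      p ^ k * X ^ v * K ^ v                         ≡⟨ trans (*-assoc (p ^ k) _ _) (cong (p ^ k *_) (sym (^-distribʳ-* X K v))) ⟩
      p ^ k * (X * K) ^ v                           ≡⟨ cong (λ z → p ^ k * z ^ v) (2ν+1 i) ⟨
      p ^ k * suc s ^ v                             ≤⟨ *-monoʳ-≤ (p ^ k) (^-decrement s v) ⟩
      p ^ k * (s ^ v + v * suc s ^ pred v)          ≡⟨ *-distribˡ-+ (p ^ k) (s ^ v) _ ⟩
      p ^ k * s ^ v + p ^ k * (v * suc s ^ pred v)  <⟨ +-monoʳ-< (p ^ k * s ^ v) slack ⟩
      p ^ k * s ^ v + K ^ v                         ∎)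
    base : p ^ (m + suc i * v) < p ^ k * ν i ^ v
    base = *-cancelˡ-< (2 ^ v) _ _ (subst₂ _<_ lhs rhs doubled)
      where
      regroup : ∀ a b c d → a * (b * c) * d ≡ b * (a * (c * d))
      regroup = solve-∀
      front : ∀ a b c → a * (b * c) ≡ b * (a * c)
      front = solve-∀
      lhs : p ^ m * (2 * p) ^ v * K ^ v ≡ 2 ^ v * p ^ (m + suc i * v)
      lhs = begin-equality
        p ^ m * (2 * p) ^ v * K ^ v           ≡⟨ cong (λ z → p ^ m * z * K ^ v) (^-distribʳ-* 2 p v) ⟩
        p ^ m * (2 ^ v * p ^ v) * K ^ v       ≡⟨ regroup (p ^ m) (2 ^ v) (p ^ v) (K ^ v) ⟩
        2 ^ v * (p ^ m * (p ^ v * K ^ v))     ≡⟨ cong (λ z → 2 ^ v * (p ^ m * z)) (trans (sym (^-distribʳ-* p K v)) (^-*-assoc p (suc i) v)) ⟩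
        2 ^ v * (p ^ m * p ^ (suc i * v))     ≡⟨ cong (2 ^ v *_) (^-distribˡ-+-* p m (suc i * v)) ⟨
        2 ^ v * p ^ (m + suc i * v)           ∎
      rhs : p ^ k * s ^ v ≡ 2 ^ v * (p ^ k * ν i ^ v)
      rhs = trans (cong (p ^ k *_) (^-distribʳ-* 2 (ν i) v)) (front (p ^ k) (2 ^ v) (ν i ^ v))
    coef : 4 * T p * F p (ν i) ≤ (4 * F p n₀ + row p n₀) * T p ^ suc i
    coef = begin
      4 * T p * F p (ν i)                          ≡⟨ left (T p) (F p (ν i)) ⟩
      T p * (4 * F p (ν i))                        ≤⟨ *-monoʳ-≤ (T p) (m≤m+n _ (row p (ν i))) ⟩
      T p * (4 * F p (ν i) + row p (ν i))          ≡⟨ cong (T p *_) (4F+row i) ⟩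
      T p * ((4 * F p n₀ + row p n₀) * T p ^ i)    ≡⟨ right (T p) (4 * F p n₀ + row p n₀) (T p ^ i) ⟩
      (4 * F p n₀ + row p n₀) * T p ^ suc i        ∎
      where
      left : ∀ t f → 4 * t * f ≡ t * (4 * f)
      left = solve-∀
      right : ∀ a b c → a * (b * c) ≡ b * (a * c)
      right = solve-∀

-- The primes of the table.

record Entry : Set where
  constructor entry
  field
    p ξ η Q⁻ d⁻ Q⁺ d⁺ : ℕ

  h = ⌊ p /2⌋
  r = h ∸ η
  n₀ = p * ξ + r
  -- The point of equality is X / D = (n₀ + 1/2) / p, with value A / E = (F(n₀) + row(n₀) / 4) / T.
  -- Closed forms for the digits ξ and r make `A` computable without evaluating `F`; `A≡` justifies
  -- them.
  A = 4 * (T p * tri ξ + suc ξ * tri r) + suc ξ * suc r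
  E = 4 * T p
  X = suc (2 * n₀)
  D = 2 * p

  -- C⁺ / e is the slope of the secant of ψ from 1/2 to 1/2 + 1/p, and C⁻ / e is the
  -- least slope for which the induction on digits then closes to the left of 1/2.
  e  = 4 * (suc h * suc h)
  C⁻ = (4 * h + 1) * suc h + 1
  C⁺ = (4 * h + 5) * suc h

  open Certificates p e C⁻ C⁺ A E X D Q⁻ d⁻ Q⁺ d⁺ public

  Valid : Set
  Valid = Prime p × p ≡ 2 * h + 1 × ξ < p × r < p
    × Bcoef p ξ η ℚ.* ℕ→ℚ E ≡ ℕ→ℚ A
    × Bbase p ξ η ℚ.* ℕ→ℚ D ≡ ℕ→ℚ X
    × Certificate

  valid? : Dec Valid
  valid? = prime? p ×-dec (p ≟ 2 * h + 1) ×-dec (ξ <? p) ×-dec (r <? p)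
    ×-dec (_ ℚ.≟ _) ×-dec (_ ℚ.≟ _) ×-dec certificate?

  isBeta : Valid → IsBeta p (B p ξ η)
  isBeta (pp , p≡ , ξ<p , r<p , a≡ , x≡ , cert) =
      (λ n 1≤n → Le-from-ℕ {p} {A = A} {E} {X} {D} n a≡ x≡
        (Descent.certified pp e C⁻ C⁺ A E X D Q⁻ d⁻ Q⁺ d⁺ cert n 1≤n))
    , (λ q _ → inf-from-ℕ {p} {A = A} {E} {X} {D} a≡ x≡
        (subst (λ a → Approximable p a E X D) A≡ (Approximation.approximable pp h p≡ n₀)) q)
    where
    open Lucas pp
    open Blocks pp
    instance
      p≢0 : NonZero p
      p≢0 = prime⇒nonZero pp
      t≢0 : NonZero (T p)
      t≢0 = T≢0
      D≢0 : NonZero D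
      D≢0 = m*n≢0 2 p
      E≢0 : NonZero E
      E≢0 = m*n≢0 4 (T p)
    A≡ : 4 * F p n₀ + row p n₀ ≡ A
    A≡ = cong₂ (λ f s → 4 * f + s)
      (trans (F-digit ξ (<⇒≤ r<p)) (cong₂ (λ f s → T p * f + s * tri r) (F-small (<⇒≤ ξ<p)) (row-small ξ<p)))
      (trans (row-digit ξ r<p) (cong (_* suc r) (row-small ξ<p)))

-- p, ξ, η, followed by rationals (Q⁻ + d⁻) / Q⁻ ≤ ϱ ≤ (Q⁺ + d⁺) / Q⁺ that are precise
-- enough for the certificate.
entries : List Entry
entries =
  entry 3 1 0 5 3 3 2 ∷
  entry 5 1 0 3 2 4 3 ∷
  entry 7 1 0 10 7 4 3 ∷
  entry 11 1 1 3 2 4 3 ∷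
  entry 13 1 1 3 2 9 7 ∷
  entry 17 1 1 4 3 9 7 ∷
  entry 19 1 1 4 3 23 18 ∷
  entry 23 1 1 14 11 29 23 ∷
  entry 29 2 1 51 41 6 5 ∷
  entry 31 2 2 5 4 26 21 ∷
  entry 37 2 2 5 4 11 9 ∷
  entry 41 2 2 5 4 17 14 ∷
  entry 43 2 2 5 4 17 14 ∷
  entry 47 2 2 11 9 6 5 ∷
  entry 53 2 2 47 39 6 5 ∷
  entry 59 2 3 5 4 19 16 ∷
  entry 61 2 3 5 4 13 11 ∷
  entry 67 2 3 6 5 13 11 ∷
  entry 71 2 3 6 5 13 11 ∷
  entry 73 2 3 6 5 13 11 ∷
  entry 79 2 3 32 27 13 11 ∷
  entry 83 2 4 6 5 13 11 ∷
  entry 89 2 4 6 5 20 17 ∷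
  entry 97 2 4 13 11 27 23 ∷
  entry 101 2 4 13 11 34 29 ∷
  entry 103 2 4 20 17 34 29 ∷
  entry 107 2 4 280 239 41 35 ∷
  entry 109 2 5 6 5 55 47 ∷
  entry 113 2 5 6 5 76 65 ∷
  []

entries-valid : All Entry.Valid entries
entries-valid = from-yes (all? Entry.valid? entries)

key : Entry → ℕ × ℕ × ℕ
key e = Entry.p e , Entry.ξ e , Entry.η e

table-entries : map key entries ≡ table
table-entries = refl

table-isBeta : ∀ (p ξ η : ℕ) → (p , ξ , η) ∈ table → IsBeta p (B p ξ η)
table-isBeta p ξ η ∈table with ∈-map⁻ key (subst ((p , ξ , η) ∈_) (sym table-entries) ∈table)
... | (e , e∈ , refl) = Entry.isBeta e (lookup entries-valid e∈)

open import Data.Integer using (+_)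

theorem1p1 : IsBeta 5 (+ 3 / 2 , + 3 / 2)
    × IsBeta 7 (+ 3 / 2 , + 3 / 2)
    × IsBeta 11 (+ 59 / 44 , + 31 / 22)
    × (∀ (p ξ η : ℕ) → (p , ξ , η) ∈ table → IsBeta p (B p ξ η))
theorem1p1 =
    -- Here `B` at the table entries evaluates to the stated pairs of fractions.
    table-isBeta 5 1 0 (there (here refl))
  , table-isBeta 7 1 0 (there (there (here refl)))
  , table-isBeta 11 1 1 (there (there (there (here refl))))
  , table-isBeta
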